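{- Let $d \ge 0$ be an integer and let $P \subset \mathbb{R}^d$ be a lattice simplex (a $d$-dimensional simplex all of whose vertices lie in $\mathbb{Z}^d$). Then $P$ is $\mu_{\mathrm{nl}}$-measurable, and \[\mu_{\mathrm{nl}}(P) = \binom{2d+1}{d}^{ -1}\mathrm{vol}(P).\]
   Context: A polytope is a $d$-dimensional convex polytope in $\mathbb{R}^d$. Two polytopes are similar ($M \sim P$) if one is the image of the other under a similarity transformation of $\mathbb{R}^d$. A miniature of a polytope $P$ is a polytope $M \subset \mathbb{R}^d$ with $M \subset P$ and $M \sim P$; it is horizontal if $M = cP + a$ for some real $c>0$ and $a \in \mathbb{R}^d$ (i.e. $M$ is transformed into $P$ by translating and rescaling). For an integer $n>0$, a miniature $M$ has resolution $n$ if every vertex of $M$ lies in $(\mathbb{Z}[1/n])^d$. Let $\mathcal{H}_n(P)$ denote the set of all horizontal miniatures of $P$ with resolution $n$. A lattice polytope $P$ is called $\mu_{\mathrm{nl}}$-measurable if the limit \[\mu_{\mathrm{nl}}(P) := \lim_{n\to\infty} \frac{\sum_{M \in \mathcal{H}_n(P)} \mathrm{vol}(M)}{\#\mathcal{H}_n(P)}\] exists in $\mathbb{R}$, where $\mathrm{vol}$ denotes $d$-dimensional volume.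
   Formalization: Resolution n is taken to mean that every vertex lies in ((1/n)Z)^d; with Z[1/n] read as the ring generated by 1/n, the set H_n(P) would be infinite for n ≥ 2 and d ≥ 1 and the average undefined. -}

module Defs where

open import Data.Nat using (ℕ; zero; suc; _!)
open import Data.Nat.Combinatorics using (_C_)
open import Data.Integer using (ℤ; +_)
open import Data.Fin using (Fin; zero; suc; punchIn)
open import Data.Vec using (Vec; lookup)
open import Data.List using (List; []; _∷_; length)
open import Data.List.Membership.Propositional using (_∈_)
open import Data.List.Relation.Unary.Unique.Propositional using (Unique)
open import Data.Rational using (ℚ; _+_; _*_; _-_; -_; _≤_; _<_; ∣_∣; 0ℚ; 1ℚ; _/_)
open import Data.Product using (Σ; ∃; _×_)
open import Function.Bundles using (_⇔_)
open import Relation.Binary.PropositionalEquality using (_≡_)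

Point : ℕ → Set
Point d = Vec ℚ d

VertexTuple : ℕ → Set
VertexTuple d = Vec (Point d) (suc d)

fromℤ : ℤ → ℚ
fromℤ z = z / 1

fromℕ : ℕ → ℚ
fromℕ n = (+ n) / 1

-- 1/k for a natural k (with the junk value 0 for k = 0; only used for k ≠ 0)
invℕ : ℕ → ℚ
invℕ zero    = 0ℚ
invℕ (suc k) = (+ 1) / suc k

sumFin : ∀ {n} → (Fin n → ℚ) → ℚ
sumFin {zero}  f = 0ℚ
sumFin {suc n} f = f zero + sumFin (λ i → f (suc i))

sign : ∀ {n} → Fin n → ℚ
sign zero    = 1ℚ
sign (suc j) = - sign j

det : ∀ {m} → (Fin m → Fin m → ℚ) → ℚ
det {zero}  A = 1ℚ
det {suc m} A = sumFin (λ j → sign j * A zero j * det (λ r c → A (suc r) (punchIn j c)))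

edgeMatrix : ∀ {d} → VertexTuple d → Fin d → Fin d → ℚ
edgeMatrix w i j = lookup (lookup w (suc i)) j - lookup (lookup w zero) j

vol : ∀ {d} → VertexTuple d → ℚ
vol {d} w = ∣ det (edgeMatrix w) ∣ * invℕ (d !)

IsInteger : ℚ → Set
IsInteger q = ∃ λ (z : ℤ) → q ≡ fromℤ z

LatticeSimplex : ∀ {d} → VertexTuple d → Set
LatticeSimplex {d} v =
  (∀ (i : Fin (suc d)) (j : Fin d) → IsInteger (lookup (lookup v i) j))
  × (det (edgeMatrix v) ≡ 0ℚ → Data.Empty.⊥)
  where import Data.Empty

InHull : ∀ {d} → VertexTuple d → Point d → Set
InHull {d} v x = ∃ λ (λs : Fin (suc d) → ℚ) →
  (∀ i → 0ℚ ≤ λs i) × (sumFin λs ≡ 1ℚ) ×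
  (∀ (j : Fin d) → lookup x j ≡ sumFin (λ i → λs i * lookup (lookup v i) j))

HullSubset : ∀ {d} → VertexTuple d → VertexTuple d → Set
HullSubset {d} w v = ∀ (x : Point d) → InHull w x → InHull v x

OnGrid : ℕ → ℚ → Set
OnGrid n q = IsInteger (fromℕ n * q)

-- w is (the vertex tuple of) a horizontal miniature cP + a of P = conv(v) with resolution n:
-- w_i = c v_i + a, c > 0, conv(w) ⊆ conv(v), all vertices of w in ((1/n)ℤ)^d.
HorMin : ∀ {d} → ℕ → VertexTuple d → VertexTuple d → Set
HorMin {d} n v w =
  (∃ λ (c : ℚ) → ∃ λ (a : Point d) → (0ℚ < c) ×
     (∀ (i : Fin (suc d)) (j : Fin d) →
        lookup (lookup w i) j ≡ c * lookup (lookup v i) j + lookup a j))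
  × HullSubset w v
  × (∀ (i : Fin (suc d)) (j : Fin d) → OnGrid n (lookup (lookup w i) j))

Enumerates : ∀ {d} → ℕ → VertexTuple d → List (VertexTuple d) → Set
Enumerates n v L = Unique L × (∀ w → (w ∈ L) ⇔ HorMin n v w)

sumVol : ∀ {d} → List (VertexTuple d) → ℚ
sumVol []       = 0ℚ
sumVol (w ∷ ws) = vol w + sumVol ws

avgVol : ∀ {d} → List (VertexTuple d) → ℚ
avgVol L = sumVol L * invℕ (length L)

muTarget : ∀ {d} → VertexTuple d → ℚ
muTarget {d} v = vol v * invℕ ((2 Data.Nat.* d Data.Nat.+ 1) C d)
  where import Data.Nat

{-# OPTIONS --safe #-}
module Submission where

-- Let E be the matrix of edge vectors at the zeroth vertex of v. Cramer's rule gives integers D and A with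
-- E A = D I, so a horizontal miniature of resolution n has ratio c = k / (n D), and its zeroth vertex is
-- v₀ + Σ t_l / (n D) E_l; containment means k + Σ t ≤ n D, and the grid condition on (k , t) is D-periodic.
-- Cutting ℕ^(d+1) into boxes of side D, each with R admissible points, therefore squeezes the
-- number of miniatures and Σ k^d between R times sums over integer simplices of size n - 2d - 1 and n - 1,
-- and these sums are binomial coefficients:
--   #  ≈ R n^(d+1) / (d+1)!,   Σ k^d ≈ R D^d d! n^(2d+1) / (2d+1)!.
-- Since vol M = c^d vol P, the average volume tends to vol P · d! (d+1)! / (2d+1)!. The multiplicity R cancels,
-- so neither the index of the lattice nor the volume of P enters the count. For d = 0 the ratio is not
-- determined by the miniature, but P is its own only miniature.

-- The weight k^d has no convenient exact sum over a lattice simplex, whereas binomial coefficients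
-- convolve exactly. On a box, k^d is therefore compared with D^d times the rising product
-- `d ! * P d x`, which is an upper bound as it stands and a lower bound once the box is moved by d
-- in the first coordinate. That move accounts for d of the 2d + 1 by which the inner simplex is
-- smaller than n; the other d + 1 are lost because each coordinate must stay below the far face of
-- its box. Powers of a = n - 2d and b = n + 2d then enclose both sums, and Bernoulli's inequality
-- replaces (a/b)^(2d+1) by an explicit linear bound, so that the limit becomes an error estimate of
-- order 1/n with rational constants. The comparisons are made over the natural numbers with
-- denominators cleared, and are moved to ℚ only at the end.

open import Defs

-- Integers inside the rationals.

module Rationals where

  open import Data.Nat as ℕ using (ℕ; zero; suc)
  open import Data.Nat.Coprimality using (1-coprimeTo) renaming (sym to coprime-sym)
  open import Data.Integer as ℤ using (ℤ; +_; -[1+_])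
  import Data.Integer.Properties as ℤₚ
  open import Data.Fin using (Fin; zero; suc)
  open import Data.Rational
  open import Data.Rational.Properties
  open import Data.Rational.Solver using (module +-*-Solver)
  open import Data.Product using (_,_; ∃)
  open import Relation.Nullary using (Dec)
  open import Relation.Nullary.Decidable using (map′)
  open import Relation.Binary.PropositionalEquality
  open +-*-Solver using (solve; _:=_; :-_; _:-_)

  -- `z / 1` is normalised by a gcd that is stuck on a variable; with the record exposed, the
  -- numerator, the order and the arithmetic compute.
  fromℤ-mkℚ : ∀ z → fromℤ z ≡ mkℚ z 0 (coprime-sym (1-coprimeTo ℤ.∣ z ∣))
  fromℤ-mkℚ (+ n)    = normalize-coprime {n} {0} (coprime-sym (1-coprimeTo n))
  fromℤ-mkℚ -[1+ n ] = cong -_ (normalize-coprime {suc n} {0} (coprime-sym (1-coprimeTo (suc n))))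

  fromℤ-+ : ∀ x y → fromℤ (x ℤ.+ y) ≡ fromℤ x + fromℤ y
  fromℤ-+ x y = sym (trans (cong₂ _+_ (fromℤ-mkℚ x) (fromℤ-mkℚ y))
    (cong (_/ 1) (cong₂ ℤ._+_ (ℤₚ.*-identityʳ x) (ℤₚ.*-identityʳ y))))

  fromℤ-* : ∀ x y → fromℤ (x ℤ.* y) ≡ fromℤ x * fromℤ y
  fromℤ-* x y = sym (cong₂ _*_ (fromℤ-mkℚ x) (fromℤ-mkℚ y))

  fromℤ-neg : ∀ x → fromℤ (ℤ.- x) ≡ - fromℤ x
  fromℤ-neg (+ zero)    = refl
  fromℤ-neg (+ (suc n)) = refl
  fromℤ-neg -[1+ n ]    = sym (neg-involutive (fromℕ (suc n)))
    where
    neg-involutive : ∀ p → - (- p) ≡ p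
    neg-involutive = solve 1 (λ p → :- (:- p) := p) refl

  ↥-fromℤ : ∀ z → ↥ (fromℤ z) ≡ z
  ↥-fromℤ z = cong ↥_ (fromℤ-mkℚ z)

  fromℤ-injective : ∀ {x y} → fromℤ x ≡ fromℤ y → x ≡ y
  fromℤ-injective {x} {y} e = trans (sym (↥-fromℤ x)) (trans (cong ↥_ e) (↥-fromℤ y))

  fromℤ-mono-≤ : ∀ {x y} → x ℤ.≤ y → fromℤ x ≤ fromℤ y
  fromℤ-mono-≤ {x} {y} x≤y = subst₂ _≤_ (sym (fromℤ-mkℚ x)) (sym (fromℤ-mkℚ y))
    (*≤* (ℤₚ.*-monoʳ-≤-nonNeg (+ 1) x≤y))

  fromℤ-cancel-≤ : ∀ {x y} → fromℤ x ≤ fromℤ y → x ℤ.≤ y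
  fromℤ-cancel-≤ {x} {y} x≤y =
    subst₂ ℤ._≤_ (ℤₚ.*-identityʳ x) (ℤₚ.*-identityʳ y)
      (drop-*≤* (subst₂ _≤_ (fromℤ-mkℚ x) (fromℤ-mkℚ y) x≤y))

  fromℕ-+ : ∀ m n → fromℕ (m ℕ.+ n) ≡ fromℕ m + fromℕ n
  fromℕ-+ m n = fromℤ-+ (+ m) (+ n)

  fromℕ-* : ∀ m n → fromℕ (m ℕ.* n) ≡ fromℕ m * fromℕ n
  fromℕ-* m n = trans (cong fromℤ (ℤₚ.pos-* m n)) (fromℤ-* (+ m) (+ n))

  fromℕ-mono-≤ : ∀ {m n} → m ℕ.≤ n → fromℕ m ≤ fromℕ n
  fromℕ-mono-≤ m≤n = fromℤ-mono-≤ (ℤ.+≤+ m≤n)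

  fromℕ-cancel-≤ : ∀ {m n} → fromℕ m ≤ fromℕ n → m ℕ.≤ n
  fromℕ-cancel-≤ m≤n = ℤₚ.drop‿+≤+ (fromℤ-cancel-≤ m≤n)

  fromℕ-injective : ∀ {m n} → fromℕ m ≡ fromℕ n → m ≡ n
  fromℕ-injective e = ℤₚ.+-injective (fromℤ-injective e)

  0≤fromℕ : ∀ n → 0ℚ ≤ fromℕ n
  0≤fromℕ n = fromℕ-mono-≤ {0} {n} ℕ.z≤n

  0<fromℕ : ∀ n .{{_ : ℕ.NonZero n}} → 0ℚ < fromℕ n
  0<fromℕ (suc n) = positive⁻¹ (fromℕ (suc n)) {{normalize-pos (suc n) 1}}

  fromℕ*invℕ : ∀ n .{{_ : ℕ.NonZero n}} → fromℕ n * invℕ n ≡ 1ℚ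
  fromℕ*invℕ (suc n) = trans
    (cong₂ _*_ (fromℤ-mkℚ (+ suc n)) (normalize-coprime {1} {n} (1-coprimeTo (suc n))))
    (*-inverseʳ (mkℚ (+ suc n) 0 (coprime-sym (1-coprimeTo (suc n)))))

  invℕ-pos : ∀ n .{{_ : ℕ.NonZero n}} → 0ℚ < invℕ n
  invℕ-pos (suc n) = positive⁻¹ (invℕ (suc n)) {{normalize-pos 1 (suc n)}}

  int-fromℕ : ∀ n → IsInteger (fromℕ n)
  int-fromℕ n = + n , refl

  int-+ : ∀ {p q} → IsInteger p → IsInteger q → IsInteger (p + q)
  int-+ (x , refl) (y , refl) = x ℤ.+ y , sym (fromℤ-+ x y)

  int-neg : ∀ {p} → IsInteger p → IsInteger (- p)
  int-neg (x , refl) = ℤ.- x , sym (fromℤ-neg x)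

  int-sub : ∀ {p q} → IsInteger p → IsInteger q → IsInteger (p - q)
  int-sub i j = int-+ i (int-neg j)

  int-* : ∀ {p q} → IsInteger p → IsInteger q → IsInteger (p * q)
  int-* (x , refl) (y , refl) = x ℤ.* y , sym (fromℤ-* x y)

  -- The numerator is the only possible witness, so one equality test in ℚ settles the existential.
  -- This makes `Good` decidable and the miniatures listable.
  isInteger? : ∀ q → Dec (IsInteger q)
  isInteger? q = map′ (λ e → ↥ q , e) (λ (z , e) → trans e (cong fromℤ (sym (trans (cong ↥_ e) (↥-fromℤ z))))) (q ≟ fromℤ (↥ q))

  nonNeg-int : ∀ {q} → IsInteger q → 0ℚ ≤ q → ∃ λ n → q ≡ fromℕ n
  nonNeg-int (+ n , e) _ = n , e
  nonNeg-int (-[1+ n ] , refl) 0≤q with fromℤ-cancel-≤ {+ 0} { -[1+ n ]} 0≤q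
  ... | ()

-- Determinants, Cramer's rule and the integral inverse up to a scalar.

module Determinants where

  open Rationals
  open import Data.Nat as ℕ using (ℕ; zero; suc)
  open import Data.Integer as ℤ using (ℤ; -[1+_])
  import Data.Integer.Properties as ℤₚ
  open import Data.Fin using (Fin; zero; suc; punchIn)
  open import Data.Fin.Properties using (_≟_)
  open import Data.Rational hiding (_≟_)
  open import Data.Rational.Properties hiding (_≟_)
  open import Data.Rational.Solver using (module +-*-Solver)
  open import Data.Product using (_,_)
  open import Relation.Nullary using (¬_)
  open import Relation.Binary.PropositionalEquality
  open +-*-Solver using (solve; _:=_; _:+_; _:*_; :-_; _:-_; con)
  open ≡-Reasoning

  sum-cong : ∀ {n} {f g : Fin n → ℚ} → (∀ i → f i ≡ g i) → sumFin f ≡ sumFin g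
  sum-cong {zero}  e = refl
  sum-cong {suc n} e = cong₂ _+_ (e zero) (sum-cong (λ i → e (suc i)))

  sum-0 : ∀ n → sumFin {n} (λ _ → 0ℚ) ≡ 0ℚ
  sum-0 zero    = refl
  sum-0 (suc n) = trans (+-identityˡ _) (sum-0 n)

  sum-+ : ∀ {n} (f g : Fin n → ℚ) → sumFin (λ i → f i + g i) ≡ sumFin f + sumFin g
  sum-+ {zero}  f g = refl
  sum-+ {suc n} f g = trans (cong ((f zero + g zero) +_) (sum-+ (λ i → f (suc i)) (λ i → g (suc i))))
    (solve 4 (λ a b c d → (a :+ b) :+ (c :+ d) := (a :+ c) :+ (b :+ d)) refl (f zero) (g zero) _ _)

  sum-*ˡ : ∀ {n} c (f : Fin n → ℚ) → sumFin (λ i → c * f i) ≡ c * sumFin f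
  sum-*ˡ {zero}  c f = sym (*-zeroʳ c)
  sum-*ˡ {suc n} c f = trans (cong (c * f zero +_) (sum-*ˡ c (λ i → f (suc i))))
    (sym (*-distribˡ-+ c (f zero) _))

  sum-*ʳ : ∀ {n} (f : Fin n → ℚ) c → sumFin (λ i → f i * c) ≡ sumFin f * c
  sum-*ʳ f c = trans (sum-cong (λ i → *-comm (f i) c)) (trans (sum-*ˡ c f) (*-comm c _))

  sum-swap : ∀ {m n} (f : Fin m → Fin n → ℚ) →
             sumFin (λ i → sumFin (f i)) ≡ sumFin (λ j → sumFin (λ i → f i j))
  sum-swap {zero}  {n} f = sym (sum-0 n)
  sum-swap {suc m} {n} f = trans (cong (sumFin (f zero) +_) (sum-swap (λ i → f (suc i))))
    (sym (sum-+ (f zero) (λ j → sumFin (λ i → f (suc i) j))))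

  sum-nonNeg : ∀ {n} {f : Fin n → ℚ} → (∀ i → 0ℚ ≤ f i) → 0ℚ ≤ sumFin f
  sum-nonNeg {zero}  h = ≤-refl
  sum-nonNeg {suc n} h = +-mono-≤ (h zero) (sum-nonNeg (λ i → h (suc i)))

  int-sum : ∀ {n} {f : Fin n → ℚ} → (∀ i → IsInteger (f i)) → IsInteger (sumFin f)
  int-sum {zero}  h = ℤ.+ 0 , refl
  int-sum {suc n} h = int-+ (h zero) (int-sum (λ i → h (suc i)))

  δ : ∀ {n} → Fin n → Fin n → ℚ
  δ zero    zero    = 1ℚ
  δ zero    (suc j) = 0ℚ
  δ (suc i) zero    = 0ℚ
  δ (suc i) (suc j) = δ i j

  sum-δ : ∀ {n} (f : Fin n → ℚ) i → sumFin (λ j → f j * δ j i) ≡ f i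
  sum-δ {suc n} f zero = trans
    (cong₂ _+_ (*-identityʳ (f zero)) (trans (sum-cong (λ j → *-zeroʳ (f (suc j)))) (sum-0 n)))
    (+-identityʳ (f zero))
  sum-δ {suc n} f (suc i) = trans
    (cong₂ _+_ (*-zeroʳ (f zero)) (sum-δ (λ j → f (suc j)) i)) (+-identityˡ (f (suc i)))

  Matrix : ℕ → Set
  Matrix n = Fin n → Fin n → ℚ

  minor : ∀ {n} → Fin (suc n) → (Fin n → Fin (suc n) → ℚ) → Matrix n
  minor j B r c = B r (punchIn j c)

  det-cong : ∀ {n} {A B : Matrix n} → (∀ i j → A i j ≡ B i j) → det A ≡ det B
  det-cong {zero}  e = refl
  det-cong {suc n} e = sum-cong (λ j →
    cong₂ _*_ (cong (sign j *_) (e zero j)) (det-cong (λ r c → e (suc r) (punchIn j c))))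

  int-sign : ∀ {n} (j : Fin n) → IsInteger (sign j)
  int-sign zero    = ℤ.+ 1 , refl
  int-sign (suc j) = int-neg (int-sign j)

  int-det : ∀ {n} {A : Matrix n} → (∀ i j → IsInteger (A i j)) → IsInteger (det A)
  int-det {zero}  h = ℤ.+ 1 , refl
  int-det {suc n} h = int-sum (λ j →
    int-* (int-* (int-sign j) (h zero j)) (int-det (λ r c → h (suc r) (punchIn j c))))

  det-scale : ∀ {n} k (A : Matrix n) →
              det (λ i j → fromℕ k * A i j) ≡ fromℕ (k ℕ.^ n) * det A
  det-scale {zero}  k A = refl
  det-scale {suc n} k A = begin
    sumFin (λ j → sign j * (x * A zero j) * det (minor j (λ r c → x * A (suc r) c)))
      ≡⟨ sum-cong (λ j → trans (cong (sign j * (x * A zero j) *_) (det-scale k (minor j (λ r → A (suc r)))))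
           (rearrange (sign j) x (A zero j) (fromℕ (k ℕ.^ n)) (det (minor j (λ r → A (suc r)))))) ⟩
    sumFin (λ j → x * fromℕ (k ℕ.^ n) * (sign j * A zero j * det (minor j (λ r → A (suc r)))))
      ≡⟨ sum-*ˡ (x * fromℕ (k ℕ.^ n)) (λ j → sign j * A zero j * det (minor j (λ r → A (suc r)))) ⟩
    x * fromℕ (k ℕ.^ n) * det A
      ≡⟨ cong (_* det A) (sym (fromℕ-* k (k ℕ.^ n))) ⟩
    fromℕ (k ℕ.* k ℕ.^ n) * det A ∎
    where
    x = fromℕ k
    rearrange : ∀ s x a y m → s * (x * a) * (y * m) ≡ x * y * (s * a * m)
    rearrange = solve 5 (λ s x a y m → s :* (x :* a) :* (y :* m) := x :* y :* (s :* a :* m)) refl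

  -- The signed sum over ordered pairs (j , l), l = punchIn j k, met in a twofold row expansion.
  pairSum : ∀ {n} → (Fin (2 ℕ.+ n) → Fin (2 ℕ.+ n) → ℚ) → ℚ
  pairSum {n} X = sumFin (λ j → sumFin (λ k → sign j * sign {suc n} k * X j (punchIn j k)))

  -- Ordered pairs of distinct indices are sorted by whether zero comes first, second or not at all.
  -- In the last case lowering both indices flips both signs, and the flips cancel.
  pairSum-suc : ∀ {n} (X : Fin (3 ℕ.+ n) → Fin (3 ℕ.+ n) → ℚ) →
    pairSum X ≡ sumFin (λ k → sign k * X zero (suc k)) + - sumFin (λ k → sign k * X (suc k) zero)
                + pairSum (λ i j → X (suc i) (suc j))
  pairSum-suc {n} X = begin
    sumFin (λ k → 1ℚ * sign k * X zero (suc k))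
      + sumFin (λ j → - sign j * 1ℚ * X (suc j) zero
          + sumFin (λ k → - sign j * - sign {suc n} k * X (suc j) (suc (punchIn j k))))
      ≡⟨ cong₂ _+_ (sum-cong (λ k → cong (_* X zero (suc k)) (*-identityˡ (sign k))))
          (sum-+ (λ j → - sign j * 1ℚ * X (suc j) zero)
            (λ j → sumFin (λ k → - sign j * - sign {suc n} k * X (suc j) (suc (punchIn j k))))) ⟩
    sumFin (λ k → sign k * X zero (suc k))
      + (sumFin (λ j → - sign j * 1ℚ * X (suc j) zero)
        + sumFin (λ j → sumFin (λ k → - sign j * - sign {suc n} k * X (suc j) (suc (punchIn j k)))))
      ≡⟨ cong (sumFin (λ k → sign k * X zero (suc k)) +_) (cong₂ _+_
          (trans (sum-cong (λ j → neg1 (sign j) (X (suc j) zero)))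
            (trans (sum-*ˡ (- 1ℚ) (λ j → sign j * X (suc j) zero))
              (solve 1 (λ s → :- con 1ℚ :* s := :- s) refl (sumFin (λ j → sign j * X (suc j) zero)))))
          (sum-cong (λ j → sum-cong (λ k → neg2 (sign j) (sign {suc n} k) (X (suc j) (suc (punchIn j k))))))) ⟩
    sumFin (λ k → sign k * X zero (suc k))
      + (- sumFin (λ k → sign k * X (suc k) zero) + pairSum (λ i j → X (suc i) (suc j)))
      ≡⟨ sym (+-assoc (sumFin (λ k → sign k * X zero (suc k))) (- sumFin (λ k → sign k * X (suc k) zero)) _) ⟩
    _ ∎
    where
    neg1 : ∀ s x → - s * 1ℚ * x ≡ - 1ℚ * (s * x)
    neg1 = solve 2 (λ s x → :- s :* con 1ℚ :* x := :- con 1ℚ :* (s :* x)) refl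
    neg2 : ∀ s t x → - s * - t * x ≡ s * t * x
    neg2 = solve 3 (λ s t x → :- s :* :- t :* x := s :* t :* x) refl

  -- Transposing `X` exchanges the two sums of `pairSum-suc` that involve index zero, and these
  -- carry opposite signs; the remainder is a smaller instance. The sign rule for a row exchange is
  -- thus obtained without permutations.
  pairSum-antisym : ∀ {n} (X : Fin (2 ℕ.+ n) → Fin (2 ℕ.+ n) → ℚ) →
                    pairSum X + pairSum (λ i j → X j i) ≡ 0ℚ
  pairSum-antisym {zero} X = solve 2 (λ a b →
      ((con 1ℚ :* con 1ℚ :* a :+ con 0ℚ) :+ ((:- con 1ℚ :* con 1ℚ :* b :+ con 0ℚ) :+ con 0ℚ))
      :+ ((con 1ℚ :* con 1ℚ :* b :+ con 0ℚ) :+ ((:- con 1ℚ :* con 1ℚ :* a :+ con 0ℚ) :+ con 0ℚ)) := con 0ℚ)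
    refl (X zero (suc zero)) (X (suc zero) zero)
  pairSum-antisym {suc n} X = begin
    pairSum X + pairSum (λ i j → X j i)
      ≡⟨ cong₂ _+_ (pairSum-suc X) (pairSum-suc (λ i j → X j i)) ⟩
    (a + - b + p) + (b + - a + q)
      ≡⟨ solve 4 (λ a b p q → (a :+ :- b :+ p) :+ (b :+ :- a :+ q) := p :+ q) refl a b p q ⟩
    p + q
      ≡⟨ pairSum-antisym (λ i j → X (suc i) (suc j)) ⟩
    0ℚ ∎
    where
    a = sumFin (λ k → sign k * X zero (suc k))
    b = sumFin (λ k → sign k * X (suc k) zero)
    p = pairSum (λ i j → X (suc i) (suc j))
    q = pairSum (λ i j → X (suc j) (suc i))

  -- The increasing enumeration of the complement of {j , l}; the value at j = l is junk.
  skip₂ : ∀ {n} → Fin (2 ℕ.+ n) → Fin (2 ℕ.+ n) → Fin n → Fin (2 ℕ.+ n)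
  skip₂ zero    zero    c       = suc (suc c)
  skip₂ zero    (suc l) c       = suc (punchIn l c)
  skip₂ (suc j) zero    c       = suc (punchIn j c)
  skip₂ (suc j) (suc l) zero    = zero
  skip₂ (suc j) (suc l) (suc c) = suc (skip₂ j l c)

  skip₂-comm : ∀ {n} (j l : Fin (2 ℕ.+ n)) c → skip₂ j l c ≡ skip₂ l j c
  skip₂-comm zero    zero    c       = refl
  skip₂-comm zero    (suc l) c       = refl
  skip₂-comm (suc j) zero    c       = refl
  skip₂-comm (suc j) (suc l) zero    = refl
  skip₂-comm (suc j) (suc l) (suc c) = cong suc (skip₂-comm j l c)

  skip₂-punchIn : ∀ {n} (j : Fin (2 ℕ.+ n)) k c → skip₂ j (punchIn j k) c ≡ punchIn j (punchIn k c)
  skip₂-punchIn zero    k       c       = refl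
  skip₂-punchIn (suc j) zero    c       = refl
  skip₂-punchIn (suc j) (suc k) zero    = refl
  skip₂-punchIn (suc j) (suc k) (suc c) = cong suc (skip₂-punchIn j k c)

  -- Indexing the minor by the columns j and l themselves, through `skip₂`, makes the term a
  -- function on pairs that can be transposed.
  expand₂ : ∀ {n} → (a b : Fin (2 ℕ.+ n) → ℚ) → (Fin n → Fin (2 ℕ.+ n) → ℚ) →
            Fin (2 ℕ.+ n) → Fin (2 ℕ.+ n) → ℚ
  expand₂ a b C j l = a j * b l * det (λ r c → C r (skip₂ j l c))

  det-expand₂ : ∀ {n} (A : Matrix (2 ℕ.+ n)) →
    det A ≡ pairSum (expand₂ (A zero) (A (suc zero)) (λ r → A (suc (suc r))))
  det-expand₂ {n} A = sum-cong (λ j → trans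
    (sym (sum-*ˡ (sign j * A zero j) (λ k → sign {suc n} k * A (suc zero) (punchIn j k)
      * det (λ r c → A (suc (suc r)) (punchIn j (punchIn k c))))))
    (sum-cong (λ k → trans
      (cong (λ z → sign j * A zero j * (sign k * A (suc zero) (punchIn j k) * z))
        (det-cong (λ r c → cong (A (suc (suc r))) (sym (skip₂-punchIn j k c)))))
      (solve 5 (λ s a t b m → s :* a :* (t :* b :* m) := s :* t :* (a :* b :* m)) refl
        (sign j) (A zero j) (sign {suc n} k) (A (suc zero) (punchIn j k)) _))))

  pairSum-cong : ∀ {n} {X Y : Fin (2 ℕ.+ n) → Fin (2 ℕ.+ n) → ℚ} →
                 (∀ i j → X i j ≡ Y i j) → pairSum X ≡ pairSum Y
  pairSum-cong e = sum-cong (λ j → sum-cong (λ k → cong (sign j * sign k *_) (e j (punchIn j k))))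

  swapRows : ∀ {n} → Matrix (2 ℕ.+ n) → Matrix (2 ℕ.+ n)
  swapRows A zero          = A (suc zero)
  swapRows A (suc zero)    = A zero
  swapRows A (suc (suc r)) = A (suc (suc r))

  -- Exchanging the top rows transposes the summand of the twofold expansion, since `skip₂` is
  -- symmetric in the two columns; antisymmetry does the rest.
  det-swap : ∀ {n} (A : Matrix (2 ℕ.+ n)) → det A + det (swapRows A) ≡ 0ℚ
  det-swap A = begin
    det A + det (swapRows A)
      ≡⟨ cong₂ _+_ (det-expand₂ A) (det-expand₂ (swapRows A)) ⟩
    pairSum X + pairSum (expand₂ (A (suc zero)) (A zero) C)
      ≡⟨ cong (pairSum X +_) (pairSum-cong (λ i j → cong₂ _*_ (*-comm (A (suc zero) i) (A zero j))
           (det-cong (λ r c → cong (C r) (skip₂-comm i j c))))) ⟩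
    pairSum X + pairSum (λ i j → X j i)
      ≡⟨ pairSum-antisym X ⟩
    0ℚ ∎
    where
    C = λ r → A (suc (suc r))
    X = expand₂ (A zero) (A (suc zero)) C

  p+p≡0⇒p≡0 : ∀ p → p + p ≡ 0ℚ → p ≡ 0ℚ
  p+p≡0⇒p≡0 p e = begin
    p           ≡⟨ solve 1 (λ p → p := con ½ :* (p :+ p)) refl p ⟩
    ½ * (p + p) ≡⟨ cong (½ *_) e ⟩
    0ℚ ∎

  -- If the copy is the second row, the swap fixes the matrix and twice its determinant is zero.
  -- Otherwise, once the top two rows are swapped, both equal rows survive in every minor of the
  -- first-row expansion, and induction applies.
  det-repeatedRow : ∀ {n} (A : Matrix (suc n)) (r : Fin n) → (∀ j → A zero j ≡ A (suc r) j) → det A ≡ 0ℚ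
  det-repeatedRow {suc n} A zero e = p+p≡0⇒p≡0 (det A) (trans (cong (det A +_) (det-cong same)) (det-swap A))
    where
    same : ∀ i j → A i j ≡ swapRows A i j
    same zero          j = e j
    same (suc zero)    j = sym (e j)
    same (suc (suc r)) j = refl
  det-repeatedRow {suc (suc n)} A (suc r) e = begin
    det A                       ≡⟨ sym (+-identityʳ (det A)) ⟩
    det A + 0ℚ                  ≡⟨ cong (det A +_) (sym zero-det) ⟩
    det A + det (swapRows A)    ≡⟨ det-swap A ⟩
    0ℚ ∎
    where
    zero-det : det (swapRows A) ≡ 0ℚ
    zero-det = trans (sum-cong (λ j → trans
        (cong (sign j * swapRows A zero j *_)
          (det-repeatedRow (minor j (λ r → swapRows A (suc r))) r (λ c → e (punchIn j c))))
        (*-zeroʳ (sign j * swapRows A zero j))))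
      (sum-0 (3 ℕ.+ n))

  -- Cramer's rule: border E by the column y and repeat row r on top; that determinant vanishes,
  -- and its first-row expansion is  y r * det E - Σ_j E r j * cramer E y j.
  bordered : ∀ {n} → Matrix n → (Fin n → ℚ) → Fin n → Fin (suc n) → ℚ
  bordered E y i zero    = y i
  bordered E y i (suc j) = E i j

  -- The determinant of `E` with column j replaced by `y`: here `y` stands in front and column j is
  -- deleted, and `sign j` accounts for moving `y` back past j columns.
  cramer : ∀ {n} → Matrix n → (Fin n → ℚ) → Fin n → ℚ
  cramer E y j = sign j * det (minor (suc j) (bordered E y))

  cramer-solves : ∀ {n} (E : Matrix n) y r → sumFin (λ j → E r j * cramer E y j) ≡ det E * y r
  cramer-solves {n} E y r = begin
    s                            ≡⟨ solve 2 (λ s t → s := t :- (t :+ :- con 1ℚ :* s)) refl s (y r * det E) ⟩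
    y r * det E - (y r * det E + - 1ℚ * s)
                                 ≡⟨ cong (λ z → y r * det E - z) (sym expansion) ⟩
    y r * det E - det B          ≡⟨ cong (λ z → y r * det E - z) (det-repeatedRow B r (λ j → refl)) ⟩
    y r * det E - 0ℚ             ≡⟨ solve 2 (λ y d → y :* d :- con 0ℚ := d :* y) refl (y r) (det E) ⟩
    det E * y r ∎
    where
    s = sumFin (λ j → E r j * cramer E y j)
    B : Matrix (suc n)
    B zero    = bordered E y r
    B (suc i) = bordered E y i
    expansion : det B ≡ y r * det E + - 1ℚ * s
    expansion = cong₂ _+_ (cong (_* det E) (*-identityˡ (y r)))
      (trans (sum-cong (λ j → solve 3 (λ s e m → :- s :* e :* m := :- con 1ℚ :* (e :* (s :* m))) refl
          (sign j) (E r j) (det (minor (suc j) (bordered E y)))))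
        (sum-*ˡ (- 1ℚ) (λ j → E r j * cramer E y j)))

  int-δ : ∀ {n} (i j : Fin n) → IsInteger (δ i j)
  int-δ zero    zero    = ℤ.+ 1 , refl
  int-δ zero    (suc j) = ℤ.+ 0 , refl
  int-δ (suc i) zero    = ℤ.+ 0 , refl
  int-δ (suc i) (suc j) = int-δ i j

  int-bordered : ∀ {n} {E : Matrix n} {y} → (∀ i j → IsInteger (E i j)) → (∀ i → IsInteger (y i)) →
                 ∀ i j → IsInteger (bordered E y i j)
  int-bordered hE hy i zero    = hy i
  int-bordered hE hy i (suc j) = hE i j

  -- The order `E A` is the one that recovers the coefficients of a combination f E of the edges, as
  -- (f E) A = D f. `D` is a natural number because it becomes both a denominator and the side of a
  -- box.
  record IntegralInverse {n} (E : Matrix n) : Set where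
    field
      D         : ℕ
      D-nonZero : ℕ.NonZero D
      A         : Matrix n
      A-int     : ∀ i j → IsInteger (A i j)
      inverse   : ∀ i l → sumFin (λ j → E i j * A j l) ≡ fromℕ D * δ i l

  integralInverse : ∀ {n} (E : Matrix n) → (∀ i j → IsInteger (E i j)) → ¬ det E ≡ 0ℚ → IntegralInverse E
  integralInverse E E-int detE≢0 with int-det E-int
  ... | z , e = record
    -- Cramer's rule for the unit vectors puts det E on the diagonal. One more factor det E makes
    -- this a square, hence a positive natural number whatever the sign.
    { D = ℤ.∣ z ∣ ℕ.* ℤ.∣ z ∣
    ; D-nonZero = ℕ.>-nonZero (ℕₚ.*-mono-< posz posz)
    ; A = λ j l → det E * cramer E (λ i → δ i l) j
    ; A-int = λ j l → int-* (z , e) (int-* (int-sign j)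
        (int-det (λ r c → int-bordered {y = λ i → δ i l} E-int (λ i → int-δ i l) r (punchIn (suc j) c))))
    ; inverse = λ i l → begin
        sumFin (λ j → E i j * (det E * cramer E (λ i → δ i l) j))
          ≡⟨ sum-cong (λ j → solve 3 (λ a d c → a :* (d :* c) := d :* (a :* c)) refl (E i j) (det E) (cramer E (λ i → δ i l) j)) ⟩
        sumFin (λ j → det E * (E i j * cramer E (λ i → δ i l) j))
          ≡⟨ sum-*ˡ (det E) (λ j → E i j * cramer E (λ i → δ i l) j) ⟩
        det E * sumFin (λ j → E i j * cramer E (λ i → δ i l) j)
          ≡⟨ cong (det E *_) (cramer-solves E (λ i → δ i l) i) ⟩
        det E * (det E * δ i l)
          ≡⟨ sym (*-assoc (det E) (det E) (δ i l)) ⟩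
        det E * det E * δ i l
          ≡⟨ cong (_* δ i l) (trans (cong₂ _*_ e e) (trans (sym (fromℤ-* z z)) (cong fromℤ (square z)))) ⟩
        fromℕ (ℤ.∣ z ∣ ℕ.* ℤ.∣ z ∣) * δ i l ∎
    }
    where
    import Data.Nat.Properties as ℕₚ
    posz : 0 ℕ.< ℤ.∣ z ∣
    posz = ℕₚ.n≢0⇒n>0 (λ z≡0 → detE≢0 (trans e (cong fromℤ (ℤₚ.∣i∣≡0⇒i≡0 {z} z≡0))))
    square : ∀ z → z ℤ.* z ≡ ℤ.+ (ℤ.∣ z ∣ ℕ.* ℤ.∣ z ∣)
    square (ℤ.+ n)   = sym (ℤₚ.pos-* n n)
    square -[1+ n ] = refl

-- Weighted counting of lists and binomial coefficients.

module Counting where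

  open import Data.Nat
  open import Data.Nat.Properties
  open import Data.Nat.DivMod using (_/_; m/n*n≡m)
  open import Data.Nat.Combinatorics using (_C_; nCk≡n!/k![n-k]!; k![n∸k]!∣n!)
  open import Data.Nat.ListAction using (sum)
  open import Data.Nat.ListAction.Properties using (sum-++)
  open import Data.Nat.Solver using (module +-*-Solver)
  open import Data.Fin using (Fin)
  open import Data.Vec using (Vec; []; _∷_; head) renaming (sum to sumᵛ)
  open import Data.Vec.Properties using (∷-injective)
  open import Data.List using (List; []; _∷_; _++_; [_]; map; length; cartesianProductWith)
  open import Data.List.Properties using (map-++; map-∘; map-cong; length-map; length-++)
  open import Data.List.Membership.Propositional using (_∈_)
  open import Data.List.Membership.Propositional.Properties
  open import Data.List.Relation.Unary.Any using (here; there)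
  open import Data.List.Relation.Unary.All as All using ()
  open import Data.List.Relation.Unary.AllPairs using ([]; _∷_)
  open import Data.List.Relation.Unary.Unique.Propositional using (Unique)
  import Data.List.Relation.Unary.Unique.Propositional.Properties as Uniqueₚ
  open import Data.Product using (_,_; _×_; proj₂)
  open import Data.Sum using (inj₁; inj₂)
  open import Data.Empty using (⊥-elim)
  open import Function using (_∘_)
  open import Relation.Nullary using (¬_)
  open import Relation.Binary.PropositionalEquality hiding ([_])
  open +-*-Solver using (solve; _:=_; _:+_; _:*_; con)

  sumBy : ∀ {A : Set} → (A → ℕ) → List A → ℕ
  sumBy f xs = sum (map f xs)

  sumBy-++ : ∀ {A : Set} (f : A → ℕ) xs ys → sumBy f (xs ++ ys) ≡ sumBy f xs + sumBy f ys
  sumBy-++ f xs ys = trans (cong sum (map-++ f xs ys)) (sum-++ (map f xs) (map f ys))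

  sumBy-map : ∀ {A B : Set} (f : B → ℕ) (g : A → B) xs → sumBy f (map g xs) ≡ sumBy (f ∘ g) xs
  sumBy-map f g xs = cong sum (sym (map-∘ xs))

  sumBy-mono : ∀ {A : Set} {f g : A → ℕ} xs → (∀ x → f x ≤ g x) → sumBy f xs ≤ sumBy g xs
  sumBy-mono []       f≤g = z≤n
  sumBy-mono (x ∷ xs) f≤g = +-mono-≤ (f≤g x) (sumBy-mono xs f≤g)

  sumBy-const : ∀ {A : Set} k (xs : List A) → sumBy (λ _ → k) xs ≡ length xs * k
  sumBy-const k []       = refl
  sumBy-const k (x ∷ xs) = cong (k +_) (sumBy-const k xs)

  sumBy-*ˡ : ∀ {A : Set} k (f : A → ℕ) xs → sumBy (λ x → k * f x) xs ≡ k * sumBy f xs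
  sumBy-*ˡ k f []       = sym (*-zeroʳ k)
  sumBy-*ˡ k f (x ∷ xs) = trans (cong (k * f x +_) (sumBy-*ˡ k f xs)) (sym (*-distribˡ-+ k (f x) _))

  sumBy-cartesianProductWith : ∀ {A B C : Set} (f : C → ℕ) (g : A → B → C) xs ys →
    sumBy f (cartesianProductWith g xs ys) ≡ sumBy (λ x → sumBy (λ y → f (g x y)) ys) xs
  sumBy-cartesianProductWith f g []       ys = refl
  sumBy-cartesianProductWith f g (x ∷ xs) ys =
    trans (sumBy-++ f (map (g x) ys) (cartesianProductWith g xs ys))
      (cong₂ _+_ (sumBy-map f (g x) ys) (sumBy-cartesianProductWith f g xs ys))

  -- Each element of `xs` is cut out of `ys` in turn, and the distinctness of `xs` keeps the
  -- remaining ones inside what is left. The larger list may be any covering list, repetitions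
  -- included.
  sumBy-⊆ : ∀ {A : Set} (f : A → ℕ) {xs ys : List A} → Unique xs → (∀ {x} → x ∈ xs → x ∈ ys) →
            sumBy f xs ≤ sumBy f ys
  sumBy-⊆ f {[]} u sub = z≤n
  sumBy-⊆ f {x ∷ xs} (x∉xs ∷ u) sub with ∈-∃++ (sub (here refl))
  ... | as , bs , refl = begin
    f x + sumBy f xs                    ≤⟨ +-monoʳ-≤ (f x) (sumBy-⊆ f u sub′) ⟩
    f x + sumBy f (as ++ bs)            ≡⟨ cong (f x +_) (sumBy-++ f as bs) ⟩
    f x + (sumBy f as + sumBy f bs)     ≡⟨ solve 3 (λ x a b → x :+ (a :+ b) := a :+ (x :+ b)) refl (f x) _ (sumBy f bs) ⟩
    sumBy f as + sumBy f (x ∷ bs)       ≡⟨ sumBy-++ f as (x ∷ bs) ⟨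
    sumBy f (as ++ x ∷ bs)              ∎
    where
    open ≤-Reasoning
    sub′ : ∀ {y} → y ∈ xs → y ∈ as ++ bs
    sub′ y∈xs with ∈-++⁻ as (sub (there y∈xs))
    ... | inj₁ y∈as           = ∈-++⁺ˡ y∈as
    ... | inj₂ (here y≡x)     = ⊥-elim (All.lookup x∉xs y∈xs (sym y≡x))
    ... | inj₂ (there y∈bs)   = ∈-++⁺ʳ as y∈bs

  length-⊆ : ∀ {A : Set} {xs ys : List A} → Unique xs → (∀ {x} → x ∈ xs → x ∈ ys) → length xs ≤ length ys
  length-⊆ {xs = xs} {ys} u sub = subst₂ _≤_ (one xs) (one ys) (sumBy-⊆ (λ _ → 1) u sub)
    where
    one : ∀ {A : Set} (zs : List A) → sumBy (λ _ → 1) zs ≡ length zs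
    one zs = trans (sumBy-const 1 zs) (*-identityʳ (length zs))

  -- P j m is the binomial coefficient (m + j) over j.
  P : ℕ → ℕ → ℕ
  P zero    m       = 1
  P (suc j) zero    = 1
  P (suc j) (suc m) = P (suc j) m + P j (suc m)

  P-0 : ∀ j → P j 0 ≡ 1
  P-0 zero    = refl
  P-0 (suc j) = refl

  P-factorial : ∀ j m → P j m * (j ! * m !) ≡ (m + j) !
  P-factorial zero    m    = trans (solve 1 (λ x → con 1 :* (con 1 :* x) := x) refl (m !)) (cong _! (sym (+-identityʳ m)))
  P-factorial (suc j) zero = solve 1 (λ x → con 1 :* (x :* con 1) := x) refl (suc j !)
  P-factorial (suc j) (suc m) = begin
    (P (suc j) m + P j (suc m)) * (suc j * j ! * (suc m * m !))
      ≡⟨ solve 6 (λ p q j m x y → (p :+ q) :* ((con 1 :+ j) :* x :* ((con 1 :+ m) :* y))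
            := p :* ((con 1 :+ j) :* x :* y) :* (con 1 :+ m) :+ q :* (x :* ((con 1 :+ m) :* y)) :* (con 1 :+ j)) refl
          (P (suc j) m) (P j (suc m)) j m (j !) (m !) ⟩
    P (suc j) m * (suc j ! * m !) * suc m + P j (suc m) * (j ! * suc m !) * suc j
      ≡⟨ cong₂ (λ a b → a * suc m + b * suc j) (trans (P-factorial (suc j) m) (cong _! (+-suc m j))) (P-factorial j (suc m)) ⟩
    (suc m + j) ! * suc m + (suc m + j) ! * suc j
      ≡⟨ solve 3 (λ x m j → x :* (con 1 :+ m) :+ x :* (con 1 :+ j) := (con 1 :+ (m :+ (con 1 :+ j))) :* x) refl ((suc m + j) !) m j ⟩
    (suc m + suc j) * (suc m + j) !
      ≡⟨ cong (λ k → (suc m + suc j) * k !) (sym (+-suc m j)) ⟩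
    (suc m + suc j) ! ∎
    where open ≡-Reasoning

  factorial-lower : ∀ j m → suc m ^ j * m ! ≤ (m + j) !
  factorial-lower zero    m = ≤-reflexive (trans (+-identityʳ (m !)) (cong _! (sym (+-identityʳ m))))
  factorial-lower (suc j) m rewrite +-suc m j = begin
    suc m * suc m ^ j * m !   ≡⟨ *-assoc (suc m) (suc m ^ j) (m !) ⟩
    suc m * (suc m ^ j * m !) ≤⟨ *-mono-≤ (s≤s (m≤m+n m j)) (factorial-lower j m) ⟩
    suc (m + j) * (m + j) !   ∎
    where open ≤-Reasoning

  factorial-upper : ∀ j k m → m + j ≤ k → (m + j) ! ≤ k ^ j * m !
  factorial-upper zero    k m m+j≤k = ≤-reflexive (trans (cong _! (+-identityʳ m)) (sym (+-identityʳ (m !))))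
  factorial-upper (suc j) k m m+j≤k rewrite +-suc m j = begin
    suc (m + j) * (m + j) !   ≤⟨ *-mono-≤ m+j≤k (factorial-upper j k m (≤-trans (n≤1+n _) m+j≤k)) ⟩
    k * (k ^ j * m !)         ≡⟨ *-assoc k (k ^ j) (m !) ⟨
    k * k ^ j * m !           ∎
    where open ≤-Reasoning

  -- `j ! * P j m` is the rising product (m + 1) ... (m + j), whose j factors are at least m + 1
  -- and, in `P-upper`, at most any k from m + j on. This is how powers are traded for binomial
  -- coefficients.
  P-lower : ∀ j m → suc m ^ j ≤ j ! * P j m
  P-lower j m = *-cancelʳ-≤ _ _ (m !) {{m !≢0}} (begin
    suc m ^ j * m !       ≤⟨ factorial-lower j m ⟩
    (m + j) !             ≡⟨ P-factorial j m ⟨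
    P j m * (j ! * m !)   ≡⟨ solve 3 (λ p x y → p :* (x :* y) := x :* p :* y) refl (P j m) (j !) (m !) ⟩
    j ! * P j m * m !     ∎)
    where open ≤-Reasoning

  P-upper : ∀ j k m → m + j ≤ k → j ! * P j m ≤ k ^ j
  P-upper j k m m+j≤k = *-cancelʳ-≤ _ _ (m !) {{m !≢0}} (begin
    j ! * P j m * m !     ≡⟨ solve 3 (λ p x y → p :* (x :* y) := x :* p :* y) refl (P j m) (j !) (m !) ⟨
    P j m * (j ! * m !)   ≡⟨ P-factorial j m ⟩
    (m + j) !             ≤⟨ factorial-upper j k m m+j≤k ⟩
    k ^ j * m !           ∎)
    where open ≤-Reasoning

  -- The Cauchy product: the sum of g i * h (m - i) over i from 0 to m, written without subtraction.
  conv : (ℕ → ℕ) → (ℕ → ℕ) → ℕ → ℕ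
  conv g h zero    = g 0 * h 0
  conv g h (suc m) = g 0 * h (suc m) + conv (g ∘ suc) h m

  conv-cong : ∀ {g g′} h m → (∀ i → g i ≡ g′ i) → conv g h m ≡ conv g′ h m
  conv-cong h zero    e = cong (_* h 0) (e 0)
  conv-cong h (suc m) e = cong₂ (λ a b → a * h (suc m) + b) (e 0) (conv-cong h m (e ∘ suc))

  conv-+ : ∀ g g′ h m → conv (λ i → g i + g′ i) h m ≡ conv g h m + conv g′ h m
  conv-+ g g′ h zero    = *-distribʳ-+ (h 0) (g 0) (g′ 0)
  conv-+ g g′ h (suc m) = trans (cong ((g 0 + g′ 0) * h (suc m) +_) (conv-+ (g ∘ suc) (g′ ∘ suc) h m))
    (solve 5 (λ a b x c d → (a :+ b) :* x :+ (c :+ d) := (a :* x :+ c) :+ (b :* x :+ d)) refl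
      (g 0) (g′ 0) (h (suc m)) (conv (g ∘ suc) h m) (conv (g′ ∘ suc) h m))

  conv-1 : ∀ j m → conv (λ _ → 1) (P j) m ≡ P (suc j) m
  conv-1 j zero    = trans (+-identityʳ (P j 0)) (P-0 j)
  conv-1 j (suc m) = trans (cong₂ _+_ (+-identityʳ (P j (suc m))) (conv-1 j m)) (+-comm (P j (suc m)) _)

  -- A Vandermonde identity: `P i` lists the coefficients of 1 / (1 - x)^(i + 1), and in the product
  -- the exponents add up to i + j + 2. The proof is a double induction on Pascal's rule.
  conv-P : ∀ i j m → conv (P i) (P j) m ≡ P (suc (i + j)) m
  conv-P zero    j m    = conv-1 j m
  conv-P (suc i) j zero = trans (+-identityʳ (P j 0)) (P-0 j)
  conv-P (suc i) j (suc m) = begin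
    P j (suc m) + 0 + conv (λ k → P (suc i) k + P i (suc k)) (P j) m
      ≡⟨ cong₂ _+_ (+-identityʳ (P j (suc m))) (conv-+ (P (suc i)) (P i ∘ suc) (P j) m) ⟩
    P j (suc m) + (conv (P (suc i)) (P j) m + conv (P i ∘ suc) (P j) m)
      ≡⟨ solve 3 (λ x a b → x :+ (a :+ b) := a :+ (con 1 :* x :+ b)) refl (P j (suc m)) (conv (P (suc i)) (P j) m) (conv (P i ∘ suc) (P j) m) ⟩
    conv (P (suc i)) (P j) m + (1 * P j (suc m) + conv (P i ∘ suc) (P j) m)
      -- The coefficient 1 is `P i 0`, the term of index zero that the shifted convolution lacks.
      ≡⟨ cong₂ _+_ (conv-P (suc i) j m) (trans (cong (λ z → z * P j (suc m) + conv (P i ∘ suc) (P j) m) (sym (P-0 i))) (conv-P i j (suc m))) ⟩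
    P (suc (suc i + j)) m + P (suc (i + j)) (suc m) ∎
    where open ≡-Reasoning

  -- Lattice points of simplices.

  bump : ∀ {j} → Vec ℕ (suc j) → Vec ℕ (suc j)
  bump (x ∷ xs) = suc x ∷ xs

  -- A vector either starts with 0 or comes from one with both first entry and bound lowered by one.
  -- These two branches are Pascal's rule for `P`, so the length obeys the same recursion.
  Δ : ∀ j → ℕ → List (Vec ℕ j)
  Δ zero    m       = [ [] ]
  Δ (suc j) zero    = map (0 ∷_) (Δ j zero)
  Δ (suc j) (suc m) = map (0 ∷_) (Δ j (suc m)) ++ map bump (Δ (suc j) m)

  ∈Δ⇒sum≤ : ∀ j m {q} → q ∈ Δ j m → sumᵛ q ≤ m
  ∈Δ⇒sum≤ zero    m (here refl) = z≤n
  ∈Δ⇒sum≤ (suc j) zero q∈ with ∈-map⁻ (0 ∷_) q∈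
  ... | q , q∈′ , refl = ∈Δ⇒sum≤ j zero q∈′
  ∈Δ⇒sum≤ (suc j) (suc m) q∈ with ∈-++⁻ (map (0 ∷_) (Δ j (suc m))) q∈
  ∈Δ⇒sum≤ (suc j) (suc m) q∈ | inj₁ q∈ˡ with ∈-map⁻ (0 ∷_) q∈ˡ
  ... | q , q∈′ , refl = ∈Δ⇒sum≤ j (suc m) q∈′
  ∈Δ⇒sum≤ (suc j) (suc m) q∈ | inj₂ q∈ʳ with ∈-map⁻ bump q∈ʳ
  ... | (x ∷ q) , q∈′ , refl = s≤s (∈Δ⇒sum≤ (suc j) m q∈′)

  sum≤⇒∈Δ : ∀ j m q → sumᵛ q ≤ m → q ∈ Δ j m
  sum≤⇒∈Δ zero    m       []          _ = here refl
  sum≤⇒∈Δ (suc j) zero    (zero ∷ q)  h = ∈-map⁺ (0 ∷_) (sum≤⇒∈Δ j zero q h)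
  sum≤⇒∈Δ (suc j) (suc m) (zero ∷ q)  h = ∈-++⁺ˡ (∈-map⁺ (0 ∷_) (sum≤⇒∈Δ j (suc m) q h))
  sum≤⇒∈Δ (suc j) (suc m) (suc x ∷ q) h =
    ∈-++⁺ʳ (map (0 ∷_) (Δ j (suc m))) (∈-map⁺ bump (sum≤⇒∈Δ (suc j) m (x ∷ q) (s≤s⁻¹ h)))

  bump-injective : ∀ {j} {p q : Vec ℕ (suc j)} → bump p ≡ bump q → p ≡ q
  bump-injective {p = x ∷ p} {y ∷ q} e with ∷-injective e
  ... | e₁ , e₂ = cong₂ _∷_ (suc-injective e₁) e₂

  Δ-unique : ∀ j m → Unique (Δ j m)
  Δ-unique zero    m       = All.[] ∷ []
  Δ-unique (suc j) zero    = Uniqueₚ.map⁺ (proj₂ ∘ ∷-injective) (Δ-unique j zero)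
  Δ-unique (suc j) (suc m) = Uniqueₚ.++⁺
    (Uniqueₚ.map⁺ (proj₂ ∘ ∷-injective) (Δ-unique j (suc m)))
    (Uniqueₚ.map⁺ bump-injective (Δ-unique (suc j) m))
    disjoint
    where
    disjoint : ∀ {q} → ¬ (q ∈ map (0 ∷_) (Δ j (suc m)) × q ∈ map bump (Δ (suc j) m))
    disjoint (q∈ , q∈′) with ∈-map⁻ (0 ∷_) q∈
    ... | _ , _ , refl with ∈-map⁻ bump q∈′
    ... | (x ∷ q) , _ , ()

  length-Δ : ∀ j m → length (Δ j m) ≡ P j m
  length-Δ zero    m       = refl
  length-Δ (suc j) zero    = trans (length-map (0 ∷_) (Δ j 0)) (trans (length-Δ j 0) (P-0 j))
  length-Δ (suc j) (suc m) = begin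
    length (Δ (suc j) (suc m))                                          ≡⟨ length-++ (map (0 ∷_) (Δ j (suc m))) ⟩
    length (map {B = Vec ℕ (suc j)} (0 ∷_) (Δ j (suc m))) + length (map bump (Δ (suc j) m))
      ≡⟨ cong₂ _+_ (trans (length-map (0 ∷_) (Δ j (suc m))) (length-Δ j (suc m)))
                   (trans (length-map bump (Δ (suc j) m)) (length-Δ (suc j) m)) ⟩
    P j (suc m) + P (suc j) m                                           ≡⟨ +-comm (P j (suc m)) _ ⟩
    P (suc j) m + P j (suc m)                                           ∎
    where open ≡-Reasoning

  -- The slice on which the first entry is i is a simplex of size m - i in j variables, with P j (m
  -- - i) points; summing over the slices is a convolution.
  sumBy-Δ : ∀ j m (g : ℕ → ℕ) → sumBy (g ∘ head) (Δ (suc j) m) ≡ conv g (P j) m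
  sumBy-Δ j zero g = begin
    sumBy (g ∘ head) (map (0 ∷_) (Δ j 0))   ≡⟨ sumBy-map (g ∘ head) (0 ∷_) (Δ j 0) ⟩
    sumBy (λ _ → g 0) (Δ j 0)               ≡⟨ sumBy-const (g 0) (Δ j 0) ⟩
    length (Δ j 0) * g 0                    ≡⟨ trans (cong (_* g 0) (length-Δ j 0)) (*-comm (P j 0) (g 0)) ⟩
    g 0 * P j 0                             ∎
    where open ≡-Reasoning
  sumBy-Δ j (suc m) g = begin
    sumBy (g ∘ head) (Δ (suc j) (suc m))
      ≡⟨ sumBy-++ (g ∘ head) (map (0 ∷_) (Δ j (suc m))) _ ⟩
    sumBy (g ∘ head) (map (0 ∷_) (Δ j (suc m))) + sumBy (g ∘ head) (map bump (Δ (suc j) m))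
      ≡⟨ cong₂ _+_ first second ⟩
    g 0 * P j (suc m) + conv (g ∘ suc) (P j) m ∎
    where
    open ≡-Reasoning
    first = trans (sumBy-map (g ∘ head) (0 ∷_) (Δ j (suc m)))
      (trans (sumBy-const (g 0) (Δ j (suc m))) (trans (cong (_* g 0) (length-Δ j (suc m))) (*-comm (P j (suc m)) (g 0))))
    second = trans (sumBy-map (g ∘ head) bump (Δ (suc j) m))
      (trans (cong sum (map-cong (λ { (x ∷ q) → refl }) (Δ (suc j) m))) (sumBy-Δ j m (g ∘ suc)))

  binomial-factorial : ∀ d → ((2 * d + 1) C d) * (d ! * suc d !) ≡ (2 * d + 1) !
  binomial-factorial d = begin
    ((2 * d + 1) C d) * (d ! * suc d !)
      ≡⟨ cong (λ k → ((2 * d + 1) C d) * (d ! * k !)) (sym diff) ⟩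
    ((2 * d + 1) C d) * (d ! * (2 * d + 1 ∸ d) !)
      ≡⟨ cong (λ z → z * (d ! * (2 * d + 1 ∸ d) !)) (nCk≡n!/k![n-k]! d≤) ⟩
    ((2 * d + 1) ! / (d ! * (2 * d + 1 ∸ d) !)) {{nz}} * (d ! * (2 * d + 1 ∸ d) !)
      ≡⟨ m/n*n≡m {{nz}} (k![n∸k]!∣n! d≤) ⟩
    (2 * d + 1) ! ∎
    where
    open ≡-Reasoning
    nz = d !* (2 * d + 1 ∸ d) !≢0
    2d+1 : 2 * d + 1 ≡ d + suc d
    2d+1 = solve 1 (λ d → con 2 :* d :+ con 1 := d :+ (con 1 :+ d)) refl d
    d≤ : d ≤ 2 * d + 1
    d≤ = subst (d ≤_) (sym 2d+1) (m≤m+n d (suc d))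
    diff : 2 * d + 1 ∸ d ≡ suc d
    diff = trans (cong (_∸ d) 2d+1) (m+n∸m≡n d (suc d))

  -- Bernoulli's inequality (1 - s/b)^k ≥ 1 - k s/b for b = y + k s, cleared of denominators: y is
  -- what remains of b after k subtractions of s.
  bernoulli : ∀ k y s → (y + k * s) ^ k * y ≤ (y + k * s ∸ s) ^ k * (y + k * s)
  bernoulli k y s = go k y (y + k * s) refl
    where
    open ≤-Reasoning
    -- The base b stays fixed while y grows by s as k drops by one; hence b is a separate variable.
    go : ∀ k y b → y + k * s ≡ b → b ^ k * y ≤ (b ∸ s) ^ k * b
    go zero    y b e = +-monoˡ-≤ 0 (≤-reflexive (trans (sym (+-identityʳ y)) e))
    go (suc k) y _ refl = begin
      b ^ suc k * y              ≡⟨ solve 3 (λ b x y → b :* x :* y := x :* (b :* y)) refl b (b ^ k) y ⟩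
      b ^ k * (b * y)            ≤⟨ *-monoʳ-≤ (b ^ k) step ⟩
      b ^ k * ((y + s) * a)      ≡⟨ *-assoc (b ^ k) (y + s) a ⟨
      b ^ k * (y + s) * a        ≤⟨ *-monoˡ-≤ a (go k (y + s) b (+-assoc y s (k * s))) ⟩
      (b ∸ s) ^ k * b * a        ≡⟨ cong (λ z → z ^ k * b * a) b∸s ⟩
      a ^ k * b * a              ≡⟨ solve 3 (λ a x b → x :* b :* a := a :* x :* b) refl a (a ^ k) b ⟩
      a ^ suc k * b              ≡⟨ cong (λ z → z ^ suc k * b) (sym b∸s) ⟩
      (b ∸ s) ^ suc k * b        ∎
      where
      b = y + (s + k * s)
      a = y + k * s
      b∸s : b ∸ s ≡ a
      b∸s = trans (cong (_∸ s) (solve 3 (λ y s t → y :+ (s :+ t) := (y :+ t) :+ s) refl y s (k * s))) (m+n∸n≡m a s)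
      step : b * y ≤ (y + s) * a
      step = subst (b * y ≤_)
        (solve 3 (λ y s k → (y :+ (s :+ k :* s)) :* y :+ s :* (k :* s) := (y :+ s) :* (y :+ k :* s)) refl y s k)
        (m≤m+n (b * y) (s * (k * s)))

-- Box decomposition of a periodic set of lattice points.

module Boxes where

  open import Data.Nat
  open import Data.Nat.Properties
  open import Data.Nat.DivMod using (_divMod_; result; _%_; [m+kn]%n≡m%n; m<n⇒m%n≡m)
  open import Data.Nat.Combinatorics using (_C_)
  open import Data.Nat.Solver using (module +-*-Solver)
  open import Data.Fin using (Fin; toℕ)
  open import Data.Fin.Properties using (toℕ<n; toℕ-injective)
  open import Data.Vec using (Vec; []; _∷_; head; zipWith; replicate) renaming (sum to sumᵛ)
  open import Data.Vec.Properties using (∷-injective)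
  open import Data.List using (List; []; _∷_; [_]; map; length; filter; allFin; cartesianProductWith)
  open import Data.List.Properties using (length-++; length-map)
  open import Data.List.Membership.Propositional using (_∈_)
  open import Data.List.Membership.Propositional.Properties
  open import Data.List.Relation.Unary.Any using (here)
  open import Data.List.Relation.Unary.All as All using ()
  open import Data.List.Relation.Unary.AllPairs using ([]; _∷_)
  open import Data.List.Relation.Unary.Unique.Propositional using (Unique)
  import Data.List.Relation.Unary.Unique.Propositional.Properties as Uniqueₚ
  open import Data.Product using (_,_; _×_; ∃₂)
  open import Function using (_∘_)
  open import Relation.Unary using (Decidable)
  open import Relation.Binary.PropositionalEquality hiding ([_])
  open +-*-Solver using (solve; _:=_; _:+_; _:*_; con)
  open Counting

  open ≤-Reasoning

  ^-distribʳ-* : ∀ a b k → (a * b) ^ k ≡ a ^ k * b ^ k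
  ^-distribʳ-* a b zero    = refl
  ^-distribʳ-* a b (suc k) = trans (cong (a * b *_) (^-distribʳ-* a b k))
    (solve 4 (λ a b x y → a :* b :* (x :* y) := (a :* x) :* (b :* y)) refl a b (a ^ k) (b ^ k))

  vectors : ∀ {A : Set} → List A → ∀ j → List (Vec A j)
  vectors xs zero    = [ [] ]
  vectors xs (suc j) = cartesianProductWith _∷_ xs (vectors xs j)

  vectors-complete : ∀ {A : Set} {xs : List A} → (∀ x → x ∈ xs) → ∀ {j} (v : Vec A j) → v ∈ vectors xs j
  vectors-complete all []      = here refl
  vectors-complete all (x ∷ v) = ∈-cartesianProductWith⁺ _∷_ (all x) (vectors-complete all v)

  vectors-unique : ∀ {A : Set} {xs : List A} → Unique xs → ∀ j → Unique (vectors xs j)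
  vectors-unique u zero    = All.[] ∷ []
  vectors-unique u (suc j) = Uniqueₚ.cartesianProductWith⁺ _∷_ ∷-injective u (vectors-unique u j)

  length-cartesianProductWith : ∀ {A B C : Set} (f : A → B → C) xs ys →
    length (cartesianProductWith f xs ys) ≡ length ys * length xs
  length-cartesianProductWith f []       ys = sym (*-zeroʳ (length ys))
  length-cartesianProductWith f (x ∷ xs) ys = trans (length-++ (map (f x) ys))
    (trans (cong₂ _+_ (length-map (f x) ys) (length-cartesianProductWith f xs ys)) (sym (*-suc (length ys) (length xs))))

  module Periodic (D : ℕ) .{{_ : NonZero D}} (d : ℕ)
    (Good : Vec ℕ (suc d) → Set) (good? : Decidable Good) where

    digit : ℕ → Fin D → ℕ
    digit q r = toℕ r + q * D

    comb : ∀ {j} → Vec ℕ j → Vec (Fin D) j → Vec ℕ j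
    comb = zipWith digit

    digit-injective : ∀ {q q′ r r′} → digit q r ≡ digit q′ r′ → q ≡ q′ × r ≡ r′
    digit-injective {q} {q′} {r} {r′} e = q≡q′ , toℕ-injective r≡r′
      where
      remainder : ∀ q (r : Fin D) → digit q r % D ≡ toℕ r
      remainder q r = trans ([m+kn]%n≡m%n (toℕ r) q D) (m<n⇒m%n≡m (toℕ<n r))
      r≡r′ : toℕ r ≡ toℕ r′
      r≡r′ = trans (sym (remainder q r)) (trans (cong (_% D) e) (remainder q′ r′))
      q≡q′ : q ≡ q′
      q≡q′ = *-cancelʳ-≡ q q′ D (+-cancelˡ-≡ (toℕ r) (q * D) (q′ * D)
        (trans e (cong (_+ q′ * D) (sym r≡r′))))

    comb-injective : ∀ {j} {q q′ : Vec ℕ j} {r r′} → comb q r ≡ comb q′ r′ → q ≡ q′ × r ≡ r′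
    comb-injective {q = []}    {[]}     {[]}    {[]}     e = refl , refl
    comb-injective {q = x ∷ q} {y ∷ q′} {a ∷ r} {b ∷ r′} e with ∷-injective e
    ... | e₁ , e₂ with digit-injective {x} {y} {a} {b} e₁ | comb-injective {q = q} {q′} {r} {r′} e₂
    ... | refl , refl | refl , refl = refl , refl

    comb-surjective : ∀ {j} (p : Vec ℕ j) → ∃₂ λ q r → p ≡ comb q r
    comb-surjective []      = [] , [] , refl
    comb-surjective (x ∷ p) with x divMod D | comb-surjective p
    ... | result q₀ r₀ e | q , r , refl = q₀ ∷ q , r₀ ∷ r , cong (_∷ _) e

    sum-comb-lower : ∀ {j} (q : Vec ℕ j) r → sumᵛ q * D ≤ sumᵛ (comb q r)
    sum-comb-lower []      []      = z≤n
    sum-comb-lower (x ∷ q) (a ∷ r) = begin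
      (x + sumᵛ q) * D                      ≡⟨ *-distribʳ-+ D x (sumᵛ q) ⟩
      x * D + sumᵛ q * D                    ≤⟨ +-mono-≤ (m≤n+m (x * D) (toℕ a)) (sum-comb-lower q r) ⟩
      digit x a + sumᵛ (comb q r)           ∎

    digit-upper : ∀ q r → suc (digit q r) ≤ suc q * D
    digit-upper q r = +-monoˡ-≤ (q * D) (toℕ<n r)

    -- The summand j on the left records one unit per coordinate, since each lies strictly below the
    -- far face of its box.
    sum-comb-upper : ∀ {j} (q : Vec ℕ j) r → sumᵛ (comb q r) + j ≤ (sumᵛ q + j) * D
    sum-comb-upper []      []      = z≤n
    sum-comb-upper {suc j} (x ∷ q) (a ∷ r) = begin
      digit x a + sumᵛ (comb q r) + suc j   ≡⟨ solve 3 (λ x s j → x :+ s :+ (con 1 :+ j) := con 1 :+ x :+ (s :+ j)) refl (digit x a) (sumᵛ (comb q r)) j ⟩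
      suc (digit x a) + (sumᵛ (comb q r) + j) ≤⟨ +-mono-≤ (digit-upper x a) (sum-comb-upper q r) ⟩
      suc x * D + (sumᵛ q + j) * D          ≡⟨ solve 4 (λ x s j D → (con 1 :+ x) :* D :+ (s :+ j) :* D := (x :+ s :+ (con 1 :+ j)) :* D) refl x (sumᵛ q) j D ⟩
      (x + sumᵛ q + suc j) * D              ∎

    residues : List (Vec (Fin D) (suc d))
    residues = filter (good? ∘ comb (replicate (suc d) 0)) (vectors (allFin D) (suc d))

    R : ℕ
    R = length residues

    -- The first entry stores k - 1, as k is positive; the condition k + Σ t ≤ n D therefore bounds
    -- the sum of the entries by n D - 1, and `weight` restores k.
    points : ℕ → List (Vec ℕ (suc d))
    points n = filter good? (Δ (suc d) (n * D ∸ 1))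

    weight : Vec ℕ (suc d) → ℕ
    weight p = suc (head p) ^ d

    -- Moving up by d boxes gives k ≥ (x + d) D, and (x + d)^d dominates the rising product
    -- `d ! * P d x`, which on the unmoved box bounds the weight from above.
    shift : Vec ℕ (suc d) → Vec ℕ (suc d)
    shift (x ∷ q) = x + d ∷ q

    inner outer : ℕ → List (Vec ℕ (suc d))
    inner m = cartesianProductWith (comb ∘ shift) (Δ (suc d) m) residues
    outer m = cartesianProductWith comb (Δ (suc d) m) residues

    weight-comb≤ : ∀ q r → D ^ d * (d ! * P d (head q)) ≥ weight (comb q r)
    weight-comb≤ (x ∷ q) (a ∷ r) = begin
      suc (digit x a) ^ d          ≤⟨ ^-monoˡ-≤ d (digit-upper x a) ⟩
      (suc x * D) ^ d              ≡⟨ trans (^-distribʳ-* (suc x) D d) (*-comm (suc x ^ d) (D ^ d)) ⟩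
      D ^ d * suc x ^ d            ≤⟨ *-monoʳ-≤ (D ^ d) (P-lower d x) ⟩
      D ^ d * (d ! * P d x)        ∎

    ≤weight-comb : ∀ q r → D ^ d * (d ! * P d (head q)) ≤ weight (comb (shift q) r)
    ≤weight-comb (x ∷ q) (a ∷ r) = begin
      D ^ d * (d ! * P d x)        ≤⟨ *-monoʳ-≤ (D ^ d) (P-upper d (x + d) x ≤-refl) ⟩
      D ^ d * (x + d) ^ d          ≡⟨ trans (*-comm (D ^ d) ((x + d) ^ d)) (sym (^-distribʳ-* (x + d) D d)) ⟩
      ((x + d) * D) ^ d            ≤⟨ ^-monoˡ-≤ d (m≤n⇒m≤1+n (m≤n+m ((x + d) * D) (toℕ a))) ⟩
      suc (digit (x + d) a) ^ d    ∎

    sum-of-bounds : ∀ m → sumBy (λ q → sumBy (λ _ → D ^ d * (d ! * P d (head q))) residues) (Δ (suc d) m)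
                          ≡ R * D ^ d * (d ! * P (suc (d + d)) m)
    sum-of-bounds m = begin-equality
      sumBy (λ q → sumBy (λ _ → D ^ d * (d ! * P d (head q))) residues) (Δ (suc d) m)
        ≡⟨ cong Data.Nat.ListAction.sum (map-cong (λ q → sumBy-const (D ^ d * (d ! * P d (head q))) residues) (Δ (suc d) m)) ⟩
      sumBy (λ q → R * (D ^ d * (d ! * P d (head q)))) (Δ (suc d) m)
        ≡⟨ cong Data.Nat.ListAction.sum (map-cong (λ q → solve 4 (λ r x f p → r :* (x :* (f :* p)) := r :* x :* f :* p) refl R (D ^ d) (d !) (P d (head q))) (Δ (suc d) m)) ⟩
      sumBy (λ q → R * D ^ d * d ! * P d (head q)) (Δ (suc d) m)
        ≡⟨ sumBy-*ˡ (R * D ^ d * d !) (P d ∘ head) (Δ (suc d) m) ⟩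
      R * D ^ d * d ! * sumBy (P d ∘ head) (Δ (suc d) m)
        -- One factor `P d` is the weight and the other counts the remaining d coordinates; their
        -- convolution is `P` of order 2d + 1.
        ≡⟨ cong (R * D ^ d * d ! *_) (trans (sumBy-Δ d m (P d)) (conv-P d d m)) ⟩
      R * D ^ d * d ! * P (suc (d + d)) m
        ≡⟨ *-assoc (R * D ^ d) (d !) (P (suc (d + d)) m) ⟩
      R * D ^ d * (d ! * P (suc (d + d)) m) ∎
      where
      import Data.Nat.ListAction
      open import Data.List.Properties using (map-cong)

    module _ (periodic : ∀ q q′ r → Good (comb q r) → Good (comb q′ r)) where

      points⊆outer : ∀ m {p} → p ∈ points (suc m) → p ∈ outer m
      points⊆outer m {p} p∈ with comb-surjective p | ∈-filter⁻ good? {xs = Δ (suc d) (suc m * D ∸ 1)} p∈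
      ... | q , r , refl | p∈Δ , good = ∈-cartesianProductWith⁺ comb
            (sum≤⇒∈Δ (suc d) m q (s≤s⁻¹ (*-cancelʳ-< D (sumᵛ q) (suc m) (begin-strict
               sumᵛ q * D         ≤⟨ sum-comb-lower q r ⟩
               sumᵛ (comb q r)    ≤⟨ ∈Δ⇒sum≤ (suc d) _ p∈Δ ⟩
               suc m * D ∸ 1      <⟨ ∸-monoʳ-< {suc m * D} z<s (*-mono-≤ (s≤s (z≤n {m})) (>-nonZero⁻¹ D)) ⟩
               suc m * D          ∎))))
            (∈-filter⁺ _ (vectors-complete ∈-allFin r) (periodic q (replicate (suc d) 0) r good))

      inner⊆points : ∀ m {p} → p ∈ inner m → p ∈ points (suc m + 2 * d)
      inner⊆points m {p} p∈ with ∈-cartesianProductWith⁻ (comb ∘ shift) (Δ (suc d) m) residues p∈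
      ... | q@(x ∷ q₁) , r , q∈ , r∈ , refl with ∈-filter⁻ (good? ∘ comb (replicate (suc d) 0)) {xs = vectors (allFin D) (suc d)} r∈
      ... | _ , good = ∈-filter⁺ good?
            (sum≤⇒∈Δ (suc d) _ (comb (shift q) r) (m+n≤o⇒m≤o∸n (sumᵛ (comb (shift q) r)) (begin
              sumᵛ (comb (shift q) r) + 1      ≤⟨ +-monoʳ-≤ (sumᵛ (comb (shift q) r)) (s≤s z≤n) ⟩
              sumᵛ (comb (shift q) r) + suc d  ≤⟨ sum-comb-upper (shift q) r ⟩
              -- One d comes from the shift and `suc d` from one box side per coordinate; together
              -- they make 2d and the successor on m.
              (x + d + sumᵛ q₁ + suc d) * D    ≡⟨ cong (_* D) (solve 3 (λ x s d → x :+ d :+ s :+ (con 1 :+ d) := con 1 :+ (x :+ s) :+ con 2 :* d) refl x (sumᵛ q₁) d) ⟩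
              (suc (x + sumᵛ q₁) + 2 * d) * D  ≤⟨ *-monoˡ-≤ D (+-monoˡ-≤ (2 * d) (s≤s (∈Δ⇒sum≤ (suc d) m q∈))) ⟩
              (suc m + 2 * d) * D              ∎)))
            (periodic (replicate (suc d) 0) (shift q) r good)

      inner-unique : ∀ m → Unique (inner m)
      inner-unique m = Uniqueₚ.cartesianProductWith⁺ (comb ∘ shift) inj (Δ-unique (suc d) m)
        (Uniqueₚ.filter⁺ _ (vectors-unique (Uniqueₚ.allFin⁺ D) (suc d)))
        where
        inj : ∀ {w x y z} → comb (shift w) y ≡ comb (shift x) z → w ≡ x × y ≡ z
        inj {w ∷ ws} {x ∷ xs} {y} {z} e with comb-injective {q = shift (w ∷ ws)} {shift (x ∷ xs)} {y} {z} e
        ... | e₁ , e₂ with ∷-injective e₁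
        ... | e₃ , refl = cong (_∷ ws) (+-cancelʳ-≡ d w x e₃) , e₂

      points-unique : ∀ n → Unique (points n)
      points-unique n = Uniqueₚ.filter⁺ good? (Δ-unique (suc d) (n * D ∸ 1))

      count-lower : ∀ m → R * P (suc d) m ≤ length (points (suc m + 2 * d))
      count-lower m = begin
        R * P (suc d) m                    ≡⟨ cong (R *_) (length-Δ (suc d) m) ⟨
        R * length (Δ (suc d) m)           ≡⟨ length-cartesianProductWith (comb ∘ shift) (Δ (suc d) m) residues ⟨
        length (inner m)                   ≤⟨ length-⊆ (inner-unique m) (inner⊆points m) ⟩
        length (points (suc m + 2 * d))    ∎

      count-upper : ∀ m → length (points (suc m)) ≤ R * P (suc d) m
      count-upper m = begin
        length (points (suc m))            ≤⟨ length-⊆ (points-unique (suc m)) (points⊆outer m) ⟩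
        length (outer m)                   ≡⟨ length-cartesianProductWith comb (Δ (suc d) m) residues ⟩
        R * length (Δ (suc d) m)           ≡⟨ cong (R *_) (length-Δ (suc d) m) ⟩
        R * P (suc d) m                    ∎

      weight-sum-lower : ∀ m → R * D ^ d * (d ! * P (suc (d + d)) m) ≤ sumBy weight (points (suc m + 2 * d))
      weight-sum-lower m = begin
        R * D ^ d * (d ! * P (suc (d + d)) m)    ≡⟨ sum-of-bounds m ⟨
        _                                        ≤⟨ sumBy-mono (Δ (suc d) m) (λ q → sumBy-mono residues (≤weight-comb q)) ⟩
        sumBy (λ q → sumBy (λ r → weight (comb (shift q) r)) residues) (Δ (suc d) m)
                                                 ≡⟨ sumBy-cartesianProductWith weight (comb ∘ shift) (Δ (suc d) m) residues ⟨
        sumBy weight (inner m)                   ≤⟨ sumBy-⊆ weight (inner-unique m) (inner⊆points m) ⟩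
        sumBy weight (points (suc m + 2 * d))    ∎

      weight-sum-upper : ∀ m → sumBy weight (points (suc m)) ≤ R * D ^ d * (d ! * P (suc (d + d)) m)
      weight-sum-upper m = begin
        sumBy weight (points (suc m))            ≤⟨ sumBy-⊆ weight (points-unique (suc m)) (points⊆outer m) ⟩
        sumBy weight (outer m)                   ≡⟨ sumBy-cartesianProductWith weight comb (Δ (suc d) m) residues ⟩
        sumBy (λ q → sumBy (λ r → weight (comb q r)) residues) (Δ (suc d) m)
                                                 ≤⟨ sumBy-mono (Δ (suc d) m) (λ q → sumBy-mono residues (weight-comb≤ q)) ⟩
        _                                        ≡⟨ sum-of-bounds m ⟩
        R * D ^ d * (d ! * P (suc (d + d)) m)    ∎

      -- Write a = m + 1, n = a + 2d, b = n + 2d and K = 2d + 1. By P-lower and P-upper the number of points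
      -- lies between R a^(d+1) / (d+1)! and R b^(d+1) / (d+1)!, and their total weight between
      -- R D^d d! a^K / K! and R D^d d! b^K / K!; bernoulli compares a^K with b^K.
      module Estimate (m y : ℕ) where

        n N K a b s S count : ℕ
        n = suc m + 2 * d
        N = n * D
        K = suc (d + d)
        a = suc m
        s = 4 * d
        b = suc m + s
        S = sumBy weight (points n)
        count = length (points n)

        private
          2d≤4d : 2 * d ≤ 4 * d
          2d≤4d = *-monoˡ-≤ d {2} {4} (s≤s (s≤s z≤n))

          F = d ! * suc d !

          n≤b : n ≤ b
          n≤b = +-monoʳ-≤ (suc m) 2d≤4d

          a≤n : a ≤ n
          a≤n = m≤m+n (suc m) (2 * d)

          -- The rising products end at m + 2d + j. For j = K this is exactly b, which is where its
          -- 4d comes from: 2d from n - 1 = m + 2d, and 2d + 1 from K.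
          top : ∀ {j} → j ≤ K → m + 2 * d + j ≤ b
          top {j} j≤K = begin
            m + 2 * d + j        ≤⟨ +-monoʳ-≤ (m + 2 * d) j≤K ⟩
            m + 2 * d + K        ≡⟨ solve 2 (λ m d → m :+ con 2 :* d :+ (con 1 :+ (d :+ d)) := con 1 :+ m :+ con 4 :* d) refl m d ⟩
            b                    ∎

          S-upper : K ! * S ≤ R * D ^ d * d ! * b ^ K
          S-upper = begin
            K ! * S                                        ≤⟨ *-monoʳ-≤ (K !) (weight-sum-upper (m + 2 * d)) ⟩
            K ! * (R * D ^ d * (d ! * P K (m + 2 * d)))    ≡⟨ solve 4 (λ k r f p → k :* (r :* (f :* p)) := r :* f :* (k :* p)) refl (K !) (R * D ^ d) (d !) (P K (m + 2 * d)) ⟩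
            R * D ^ d * d ! * (K ! * P K (m + 2 * d))      ≤⟨ *-monoʳ-≤ (R * D ^ d * d !) (P-upper K b (m + 2 * d) (top ≤-refl)) ⟩
            R * D ^ d * d ! * b ^ K                        ∎

          S-lower : R * D ^ d * d ! * a ^ K ≤ K ! * S
          S-lower = begin
            R * D ^ d * d ! * a ^ K                        ≤⟨ *-monoʳ-≤ (R * D ^ d * d !) (P-lower K m) ⟩
            R * D ^ d * d ! * (K ! * P K m)                ≡⟨ solve 4 (λ k r f p → r :* f :* (k :* p) := k :* (r :* (f :* p))) refl (K !) (R * D ^ d) (d !) (P K m) ⟩
            K ! * (R * D ^ d * (d ! * P K m))              ≤⟨ *-monoʳ-≤ (K !) (weight-sum-lower m) ⟩
            K ! * S                                        ∎

          count-≥ : R * a ^ suc d ≤ suc d ! * count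
          count-≥ = begin
            R * a ^ suc d                  ≤⟨ *-monoʳ-≤ R (P-lower (suc d) m) ⟩
            R * (suc d ! * P (suc d) m)    ≡⟨ solve 3 (λ r f p → r :* (f :* p) := f :* (r :* p)) refl R (suc d !) (P (suc d) m) ⟩
            suc d ! * (R * P (suc d) m)    ≤⟨ *-monoʳ-≤ (suc d !) (count-lower m) ⟩
            suc d ! * count                ∎

          count-≤ : suc d ! * count ≤ R * b ^ suc d
          count-≤ = begin
            suc d ! * count                            ≤⟨ *-monoʳ-≤ (suc d !) (count-upper (m + 2 * d)) ⟩
            suc d ! * (R * P (suc d) (m + 2 * d))      ≡⟨ solve 3 (λ r f p → f :* (r :* p) := r :* (f :* p)) refl R (suc d !) (P (suc d) (m + 2 * d)) ⟩
            R * (suc d ! * P (suc d) (m + 2 * d))      ≤⟨ *-monoʳ-≤ R (P-upper (suc d) b (m + 2 * d) (top (s≤s (m≤m+n d d)))) ⟩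
            R * b ^ suc d                              ∎

          split : ∀ x → x ^ K ≡ x ^ suc d * x ^ d
          split x = ^-distribˡ-+-* x (suc d) d

          N^d : N ^ d ≡ n ^ d * D ^ d
          N^d = ^-distribʳ-* n D d

          -- Since K = (d + 1) + d, the power a^K splits into a^(d+1), absorbed by the count, and
          -- a^d, absorbed by n^d. `R` is handed over from the bound on `S` to the bound on the
          -- count instead of being divided out.
          ratio-upper : K ! * S * a ^ K ≤ F * b ^ K * (N ^ d * count)
          ratio-upper = begin
            K ! * S * a ^ K                                        ≤⟨ *-monoˡ-≤ (a ^ K) S-upper ⟩
            R * D ^ d * d ! * b ^ K * a ^ K                        ≡⟨ cong (R * D ^ d * d ! * b ^ K *_) (split a) ⟩
            R * D ^ d * d ! * b ^ K * (a ^ suc d * a ^ d)          ≡⟨ solve 6 (λ r D f b a a′ → r :* D :* f :* b :* (a :* a′) := f :* b :* D :* (r :* a) :* a′) refl R (D ^ d) (d !) (b ^ K) (a ^ suc d) (a ^ d) ⟩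
            d ! * b ^ K * D ^ d * (R * a ^ suc d) * a ^ d          ≤⟨ *-mono-≤ (*-monoʳ-≤ (d ! * b ^ K * D ^ d) count-≥) (^-monoˡ-≤ d a≤n) ⟩
            d ! * b ^ K * D ^ d * (suc d ! * count) * n ^ d        ≡⟨ solve 6 (λ f b D g c n → f :* b :* D :* (g :* c) :* n := f :* g :* b :* (n :* D :* c)) refl (d !) (b ^ K) (D ^ d) (suc d !) count (n ^ d) ⟩
            F * b ^ K * (n ^ d * D ^ d * count)                    ≡⟨ cong (λ z → F * b ^ K * (z * count)) N^d ⟨
            F * b ^ K * (N ^ d * count)                            ∎

          ratio-lower : F * a ^ K * (N ^ d * count) ≤ K ! * S * b ^ K
          ratio-lower = begin
            F * a ^ K * (N ^ d * count)                            ≡⟨ cong (λ z → F * a ^ K * (z * count)) N^d ⟩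
            F * a ^ K * (n ^ d * D ^ d * count)                    ≡⟨ solve 6 (λ f a D g c n → f :* g :* a :* (n :* D :* c) := f :* a :* D :* (g :* c) :* n) refl (d !) (a ^ K) (D ^ d) (suc d !) count (n ^ d) ⟩
            d ! * a ^ K * D ^ d * (suc d ! * count) * n ^ d        ≤⟨ *-mono-≤ (*-monoʳ-≤ (d ! * a ^ K * D ^ d) count-≤) (^-monoˡ-≤ d n≤b) ⟩
            d ! * a ^ K * D ^ d * (R * b ^ suc d) * b ^ d          ≡⟨ solve 6 (λ r D f a b b′ → f :* a :* D :* (r :* b) :* b′ := r :* D :* f :* a :* (b :* b′)) refl R (D ^ d) (d !) (a ^ K) (b ^ suc d) (b ^ d) ⟩
            R * D ^ d * d ! * a ^ K * (b ^ suc d * b ^ d)          ≡⟨ cong (R * D ^ d * d ! * a ^ K *_) (split b) ⟨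
            R * D ^ d * d ! * a ^ K * b ^ K                        ≤⟨ *-monoˡ-≤ (b ^ K) S-lower ⟩
            K ! * S * b ^ K                                        ∎

          binomial : K ! ≡ ((2 * d + 1) C d) * F
          binomial = trans (cong _! (solve 1 (λ d → con 1 :+ (d :+ d) := con 2 :* d :+ con 1) refl d)) (sym (binomial-factorial d))

          instance
            F≢0 : NonZero F
            F≢0 = d !* suc d !≢0
            a^K≢0 : NonZero (a ^ K)
            a^K≢0 = m^n≢0 a K
            b^K≢0 : NonZero (b ^ K)
            b^K≢0 = m^n≢0 b K

        module _ (y+Ks≡b : y + K * s ≡ b) where

          private
            bern : b ^ K * y ≤ a ^ K * b
            bern = subst (λ z → z ^ K * y ≤ a ^ K * z) y+Ks≡b
              (subst (λ z → (y + K * s) ^ K * y ≤ z ^ K * (y + K * s))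
                (trans (cong (_∸ s) y+Ks≡b) (m+n∸n≡m a s)) (bernoulli K y s))

          -- The quotient of average and target is S β / (N^d count), with β the binomial
          -- coefficient. By `ratio-upper` it is at most (b/a)^K, and Bernoulli's inequality bounds
          -- this by b/y; `average-lower` is the reciprocal bound y/b.
          average-upper : S * ((2 * d + 1) C d) * y ≤ N ^ d * count * (y + K * s)
          average-upper = subst (λ z → S * β * y ≤ N ^ d * count * z) (sym y+Ks≡b)
            (*-cancelˡ-≤ (F * a ^ K) {{m*n≢0 F (a ^ K)}} (begin
              F * a ^ K * (S * β * y)              ≡⟨ solve 5 (λ F a S β y → F :* a :* (S :* β :* y) := β :* F :* S :* a :* y) refl F (a ^ K) S β y ⟩
              β * F * S * a ^ K * y                ≡⟨ cong (λ z → z * S * a ^ K * y) binomial ⟨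
              K ! * S * a ^ K * y                  ≤⟨ *-monoˡ-≤ y ratio-upper ⟩
              F * b ^ K * (N ^ d * count) * y      ≡⟨ solve 4 (λ F b x y → F :* b :* x :* y := F :* x :* (b :* y)) refl F (b ^ K) (N ^ d * count) y ⟩
              F * (N ^ d * count) * (b ^ K * y)    ≤⟨ *-monoʳ-≤ (F * (N ^ d * count)) bern ⟩
              F * (N ^ d * count) * (a ^ K * b)    ≡⟨ solve 4 (λ F x a b → F :* x :* (a :* b) := F :* a :* (x :* b)) refl F (N ^ d * count) (a ^ K) b ⟩
              F * a ^ K * (N ^ d * count * b)      ∎))
            where β = (2 * d + 1) C d

          average-lower : N ^ d * count * y ≤ S * ((2 * d + 1) C d) * (y + K * s)
          average-lower = subst (λ z → N ^ d * count * y ≤ S * β * z) (sym y+Ks≡b)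
            (*-cancelˡ-≤ (F * b ^ K) {{m*n≢0 F (b ^ K)}} (begin
              F * b ^ K * (N ^ d * count * y)      ≡⟨ solve 4 (λ F b x y → F :* b :* (x :* y) := F :* x :* (b :* y)) refl F (b ^ K) (N ^ d * count) y ⟩
              F * (N ^ d * count) * (b ^ K * y)    ≤⟨ *-monoʳ-≤ (F * (N ^ d * count)) bern ⟩
              F * (N ^ d * count) * (a ^ K * b)    ≡⟨ solve 4 (λ F x a b → F :* x :* (a :* b) := F :* a :* x :* b) refl F (N ^ d * count) (a ^ K) b ⟩
              F * a ^ K * (N ^ d * count) * b      ≤⟨ *-monoˡ-≤ b ratio-lower ⟩
              K ! * S * b ^ K * b                  ≡⟨ cong (λ z → z * S * b ^ K * b) binomial ⟩
              β * F * S * b ^ K * b                ≡⟨ solve 5 (λ F x S β b → β :* F :* S :* x :* b := F :* x :* (S :* β :* b)) refl F (b ^ K) S β b ⟩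
              F * b ^ K * (S * β * b)              ∎))
            where β = (2 * d + 1) C d

-- Parametrisation of the horizontal miniatures by lattice points.

module Miniatures where

  open Rationals
  open Determinants
  open import Data.Nat as ℕ using (ℕ; zero; suc)
  import Data.Nat.Properties as ℕₚ
  open import Data.Fin using (Fin; zero; suc; toℕ)
  open import Data.Fin.Properties using (all?)
  open import Data.Rational hiding (_≟_)
  open import Data.Rational.Properties hiding (_≟_)
  open import Data.Rational.Solver using (module +-*-Solver)
  open import Data.Vec using (Vec; []; _∷_; lookup; tabulate) renaming (sum to sumᵛ)
  open import Data.Vec.Properties using (lookup∘tabulate; tabulate∘lookup; tabulate-cong; lookup-zipWith)
  open import Data.Product using (_,_; _×_; ∃; proj₁; proj₂)
  open import Relation.Nullary using (contradiction)
  open import Relation.Nullary.Decidable using (_×-dec_)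
  open import Relation.Unary using (Decidable)
  open import Relation.Binary.PropositionalEquality
  open Boxes using (module Periodic)
  open +-*-Solver using (solve; _:=_; _:+_; _:*_; :-_; _:-_; con)
  open ≡-Reasoning

  vec-ext : ∀ {A : Set} {n} {xs ys : Vec A n} → (∀ i → lookup xs i ≡ lookup ys i) → xs ≡ ys
  vec-ext {xs = xs} {ys} e = trans (sym (tabulate∘lookup xs)) (trans (tabulate-cong e) (tabulate∘lookup ys))

  fromℕ-sumᵛ : ∀ {n} (t : Vec ℕ n) → fromℕ (sumᵛ t) ≡ sumFin (λ l → fromℕ (lookup t l))
  fromℕ-sumᵛ []      = refl
  fromℕ-sumᵛ (x ∷ t) = trans (fromℕ-+ x (sumᵛ t)) (cong (fromℕ x +_) (fromℕ-sumᵛ t))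

  *-nonNeg : ∀ {p q} → 0ℚ ≤ p → 0ℚ ≤ q → 0ℚ ≤ p * q
  *-nonNeg {p} {q} 0≤p 0≤q = nonNegative⁻¹ (p * q)
    {{nonNeg*nonNeg⇒nonNeg p {{nonNegative 0≤p}} q {{nonNegative 0≤q}}}}

  *-pos : ∀ {p q} → 0ℚ < p → 0ℚ < q → 0ℚ < p * q
  *-pos {p} {q} 0<p 0<q = positive⁻¹ (p * q) {{pos*pos⇒pos p {{positive 0<p}} q {{positive 0<q}}}}

  p≤q⇒0≤q-p : ∀ {p q} → p ≤ q → 0ℚ ≤ q - p
  p≤q⇒0≤q-p {p} {q} p≤q = subst (_≤ q - p) (+-inverseʳ p) (+-monoˡ-≤ (- p) p≤q)

  0≤q-p⇒p≤q : ∀ {p q} → 0ℚ ≤ q - p → p ≤ q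
  0≤q-p⇒p≤q {p} {q} h = subst₂ _≤_ (+-identityˡ p)
    (solve 2 (λ p q → q :- p :+ p := q) refl p q) (+-monoˡ-≤ p h)

  scaled⇒ : ∀ k .{{_ : ℕ.NonZero k}} {x y} → fromℕ k * x ≡ y → x ≡ y * invℕ k
  scaled⇒ k {x} {y} e = begin
    x                        ≡⟨ sym (*-identityˡ x) ⟩
    1ℚ * x                   ≡⟨ cong (_* x) (sym (fromℕ*invℕ k)) ⟩
    fromℕ k * invℕ k * x     ≡⟨ solve 3 (λ k i x → k :* i :* x := k :* x :* i) refl (fromℕ k) (invℕ k) x ⟩
    fromℕ k * x * invℕ k     ≡⟨ cong (_* invℕ k) e ⟩
    y * invℕ k               ∎

  scaled-cancel : ∀ k .{{_ : ℕ.NonZero k}} {x y} → fromℕ k * x ≡ fromℕ k * y → x ≡ y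
  scaled-cancel k {x} {y} e = trans (scaled⇒ k e) (sym (scaled⇒ k refl))

  invℕ-scaled-cancel : ∀ k .{{_ : ℕ.NonZero k}} {x y} → x * invℕ k ≡ y * invℕ k → x ≡ y
  invℕ-scaled-cancel k {x} {y} e = trans (undo x) (trans (cong (fromℕ k *_) e) (sym (undo y)))
    where
    undo : ∀ z → z ≡ fromℕ k * (z * invℕ k)
    undo z = trans (sym (*-identityʳ z)) (trans (cong (z *_) (sym (fromℕ*invℕ k)))
      (solve 3 (λ z k i → z :* (k :* i) := k :* (z :* i)) refl z (fromℕ k) (invℕ k)))

  affine-combination : ∀ {n} (f g : Fin n → ℚ) a b →
    sumFin (λ i → f i * (a + b * g i)) ≡ a * sumFin f + b * sumFin (λ i → f i * g i)
  affine-combination f g a b = begin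
    sumFin (λ i → f i * (a + b * g i))
      ≡⟨ sum-cong (λ i → solve 4 (λ f a b g → f :* (a :+ b :* g) := a :* f :+ b :* (f :* g)) refl (f i) a b (g i)) ⟩
    sumFin (λ i → a * f i + b * (f i * g i))
      ≡⟨ sum-+ (λ i → a * f i) (λ i → b * (f i * g i)) ⟩
    sumFin (λ i → a * f i) + sumFin (λ i → b * (f i * g i))
      ≡⟨ cong₂ _+_ (sum-*ˡ a f) (sum-*ˡ b (λ i → f i * g i)) ⟩
    a * sumFin f + b * sumFin (λ i → f i * g i) ∎

  module Simplex {d′ : ℕ} (v : VertexTuple (suc d′))
    (V-int : ∀ i j → IsInteger (lookup (lookup v i) j)) (inv : IntegralInverse (edgeMatrix v)) where

    d : ℕ
    d = suc d′

    V : Fin (suc d) → Fin d → ℚ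
    V i j = lookup (lookup v i) j

    E : Matrix d
    E = edgeMatrix v

    -- Unlike `E` this has a row for the zeroth vertex too, equal to zero, so that `coord` treats
    -- all vertices alike.
    e : Fin (suc d) → Fin d → ℚ
    e i j = V i j - V zero j

    e-int : ∀ i j → IsInteger (e i j)
    e-int i j = int-sub (V-int i j) (V-int zero j)

    open IntegralInverse inv public

    instance
      D≢0 : ℕ.NonZero D
      D≢0 = D-nonZero

    -- Associativity, (f E) A = f (E A) = D f. It yields that the edges are independent and that D f
    -- is integral whenever f E is.
    recover : ∀ (f : Fin d → ℚ) l → sumFin (λ j → sumFin (λ i → f i * E i j) * A j l) ≡ fromℕ D * f l
    recover f l = begin
      sumFin (λ j → sumFin (λ i → f i * E i j) * A j l)
        ≡⟨ sum-cong (λ j → sym (sum-*ʳ (λ i → f i * E i j) (A j l))) ⟩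
      sumFin (λ j → sumFin (λ i → f i * E i j * A j l))
        ≡⟨ sum-swap (λ j i → f i * E i j * A j l) ⟩
      sumFin (λ i → sumFin (λ j → f i * E i j * A j l))
        ≡⟨ sum-cong (λ i → trans (sum-cong (λ j → *-assoc (f i) (E i j) (A j l)))
            (trans (sum-*ˡ (f i) (λ j → E i j * A j l)) (cong (f i *_) (inverse i l)))) ⟩
      sumFin (λ i → f i * (fromℕ D * δ i l))
        ≡⟨ trans (sum-cong (λ i → solve 3 (λ f d x → f :* (d :* x) := d :* (f :* x)) refl (f i) (fromℕ D) (δ i l)))
            (sum-*ˡ (fromℕ D) (λ i → f i * δ i l)) ⟩
      fromℕ D * sumFin (λ i → f i * δ i l)
        ≡⟨ cong (fromℕ D *_) (sum-δ f l) ⟩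
      fromℕ D * f l ∎

    E-independent : ∀ (f g : Fin d → ℚ) → (∀ j → sumFin (λ i → f i * E i j) ≡ sumFin (λ i → g i * E i j)) →
                    ∀ l → f l ≡ g l
    E-independent f g h l = scaled-cancel D (trans (sym (recover f l))
      (trans (sum-cong (λ j → cong (_* A j l) (h j))) (recover g l)))

    recover-int : ∀ (f : Fin d → ℚ) → (∀ j → IsInteger (sumFin (λ i → f i * E i j))) →
                  ∀ l → IsInteger (fromℕ D * f l)
    recover-int f h l = subst IsInteger (recover f l) (int-sum (λ j → int-* (h j) (A-int j l)))

    -- Writes a multiple of one edge as a combination of all of them, so that independence and
    -- integrality also apply to the ratio c.
    single : ∀ c i j → sumFin (λ l → c * δ l i * E l j) ≡ c * E i j
    single c i j = begin
      sumFin (λ l → c * δ l i * E l j)     ≡⟨ sum-cong (λ l → solve 3 (λ c x e → c :* x :* e := c :* (e :* x)) refl c (δ l i) (E l j)) ⟩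
      sumFin (λ l → c * (E l j * δ l i))   ≡⟨ sum-*ˡ c (λ l → E l j * δ l i) ⟩
      c * sumFin (λ l → E l j * δ l i)     ≡⟨ cong (c *_) (sum-δ (λ l → E l j) i) ⟩
      c * E i j                            ∎

    sum-E : ∀ (f : Fin d → ℚ) j → sumFin (λ l → f l * E l j) ≡ sumFin (λ l → f l * V (suc l) j) - sumFin f * V zero j
    sum-E f j = begin
      sumFin (λ l → f l * (V (suc l) j - V zero j))
        ≡⟨ sum-cong (λ l → solve 3 (λ f x y → f :* (x :- y) := f :* (:- y :+ con 1ℚ :* x)) refl (f l) (V (suc l) j) (V zero j)) ⟩
      sumFin (λ l → f l * (- V zero j + 1ℚ * V (suc l) j))
        ≡⟨ affine-combination f (λ l → V (suc l) j) (- V zero j) 1ℚ ⟩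
      - V zero j * sumFin f + 1ℚ * sumFin (λ l → f l * V (suc l) j)
        ≡⟨ solve 3 (λ v s t → :- v :* s :+ con 1ℚ :* t := t :- s :* v) refl (V zero j) (sumFin f) (sumFin (λ l → f l * V (suc l) j)) ⟩
      sumFin (λ l → f l * V (suc l) j) - sumFin f * V zero j ∎

    barycentric : ∀ (f : Fin (suc d) → ℚ) → sumFin f ≡ 1ℚ → ∀ j →
      sumFin (λ i → f i * V i j) ≡ V zero j + sumFin (λ l → f (suc l) * E l j)
    barycentric f s j = begin
      f zero * V zero j + t
        ≡⟨ solve 4 (λ f v t s → f :* v :+ t := (f :+ s) :* v :+ (t :- s :* v)) refl (f zero) (V zero j) t s′ ⟩
      (f zero + s′) * V zero j + (t - s′ * V zero j)
        ≡⟨ cong₂ _+_ (trans (cong (_* V zero j) s) (*-identityˡ (V zero j))) (sym (sum-E (λ l → f (suc l)) j)) ⟩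
      V zero j + sumFin (λ l → f (suc l) * E l j) ∎
      where
      t = sumFin (λ l → f (suc l) * V (suc l) j)
      s′ = sumFin (λ l → f (suc l))

    -- The parameters κ ∷ t stand for the miniature with ratio c = (κ + 1) / (n D) whose zeroth vertex
    -- is v₀ + Σ t_l / (n D) E_l; Good says that it has resolution n, whatever n is.
    Good : Vec ℕ (suc d) → Set
    Good (κ ∷ t) = (∀ j → IsInteger (sumFin (λ l → fromℕ (lookup t l) * E l j) * invℕ D))
                 × (∀ i j → IsInteger (fromℕ (suc κ) * E i j * invℕ D))

    good? : Decidable Good
    good? (κ ∷ t) = all? (λ j → isInteger? _) ×-dec all? (λ i → all? (λ j → isInteger? _))

    open Periodic D d Good good? public

    fromℕ-digit : ∀ q q′ r → fromℕ (digit q′ r) ≡ fromℕ (digit q r) + (fromℕ q′ - fromℕ q) * fromℕ D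
    fromℕ-digit q q′ r = begin
      fromℕ (digit q′ r)
        ≡⟨ split q′ ⟩
      fromℕ (toℕ r) + fromℕ q′ * fromℕ D
        ≡⟨ solve 4 (λ r q p D → r :+ p :* D := (r :+ q :* D) :+ (p :- q) :* D) refl (fromℕ (toℕ r)) (fromℕ q) (fromℕ q′) (fromℕ D) ⟩
      fromℕ (toℕ r) + fromℕ q * fromℕ D + (fromℕ q′ - fromℕ q) * fromℕ D
        ≡⟨ cong (_+ (fromℕ q′ - fromℕ q) * fromℕ D) (sym (split q)) ⟩
      fromℕ (digit q r) + (fromℕ q′ - fromℕ q) * fromℕ D ∎
      where
      split : ∀ q → fromℕ (digit q r) ≡ fromℕ (toℕ r) + fromℕ q * fromℕ D
      split q = trans (fromℕ-+ (toℕ r) (q ℕ.* D)) (cong (fromℕ (toℕ r) +_) (fromℕ-* q D))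

    int-shift : ∀ x y z → IsInteger (x * invℕ D) → IsInteger z → y ≡ x + z * fromℕ D → IsInteger (y * invℕ D)
    int-shift x y z hx hz e = subst IsInteger (sym eq) (int-+ hx hz)
      where
      eq : y * invℕ D ≡ x * invℕ D + z
      eq = begin
        y * invℕ D                              ≡⟨ cong (_* invℕ D) e ⟩
        (x + z * fromℕ D) * invℕ D              ≡⟨ solve 4 (λ x z D i → (x :+ z :* D) :* i := x :* i :+ z :* (D :* i)) refl x z (fromℕ D) (invℕ D) ⟩
        x * invℕ D + z * (fromℕ D * invℕ D)     ≡⟨ cong (λ u → x * invℕ D + z * u) (fromℕ*invℕ D) ⟩
        x * invℕ D + z * 1ℚ                     ≡⟨ cong (x * invℕ D +_) (*-identityʳ z) ⟩
        x * invℕ D + z                          ∎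

    -- Changing the box alters every entry by a multiple of `D`, which the factor 1/D turns into an
    -- integral combination of integral edges.
    periodic : ∀ q q′ r → Good (comb q r) → Good (comb q′ r)
    periodic (q₀ ∷ q) (q₀′ ∷ q′) (r₀ ∷ r) (good₁ , good₂) = good₁′ , good₂′
      where
      lk : (x : Vec ℕ d) → Fin d → ℚ
      lk x l = fromℕ (lookup (comb x r) l)
      Δq : Fin d → ℚ
      Δq l = fromℕ (lookup q′ l) - fromℕ (lookup q l)
      lk-shift : ∀ l → lk q′ l ≡ lk q l + Δq l * fromℕ D
      lk-shift l rewrite lookup-zipWith digit l q r | lookup-zipWith digit l q′ r =
        fromℕ-digit (lookup q l) (lookup q′ l) (lookup r l)
      sums : ∀ j → sumFin (λ l → lk q′ l * E l j) ≡ sumFin (λ l → lk q l * E l j) + sumFin (λ l → Δq l * E l j) * fromℕ D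
      sums j = begin
        sumFin (λ l → lk q′ l * E l j)
          ≡⟨ sum-cong (λ l → trans (cong (_* E l j) (lk-shift l))
               (solve 4 (λ a b D e → (a :+ b :* D) :* e := a :* e :+ b :* e :* D) refl (lk q l) (Δq l) (fromℕ D) (E l j))) ⟩
        sumFin (λ l → lk q l * E l j + Δq l * E l j * fromℕ D)
          ≡⟨ sum-+ (λ l → lk q l * E l j) (λ l → Δq l * E l j * fromℕ D) ⟩
        sumFin (λ l → lk q l * E l j) + sumFin (λ l → Δq l * E l j * fromℕ D)
          ≡⟨ cong (sumFin (λ l → lk q l * E l j) +_) (sum-*ʳ (λ l → Δq l * E l j) (fromℕ D)) ⟩
        sumFin (λ l → lk q l * E l j) + sumFin (λ l → Δq l * E l j) * fromℕ D ∎
      Δq-int : ∀ x y → IsInteger (fromℕ x - fromℕ y)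
      Δq-int x y = int-sub (int-fromℕ x) (int-fromℕ y)
      good₁′ = λ j → int-shift (sumFin (λ l → lk q l * E l j)) _ (sumFin (λ l → Δq l * E l j)) (good₁ j)
        (int-sum (λ l → int-* (Δq-int (lookup q′ l) (lookup q l)) (e-int (suc l) j))) (sums j)
      good₂′ = λ i j → int-shift (fromℕ (suc (digit q₀ r₀)) * E i j) _ ((fromℕ q₀′ - fromℕ q₀) * E i j) (good₂ i j) (int-* (Δq-int q₀′ q₀) (e-int (suc i) j)) (begin
        fromℕ (suc (digit q₀′ r₀)) * E i j
          ≡⟨ cong (_* E i j) (trans (fromℕ-+ 1 (digit q₀′ r₀)) (cong (1ℚ +_) (fromℕ-digit q₀ q₀′ r₀))) ⟩
        (1ℚ + (fromℕ (digit q₀ r₀) + (fromℕ q₀′ - fromℕ q₀) * fromℕ D)) * E i j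
          ≡⟨ solve 4 (λ x z D e → (con 1ℚ :+ (x :+ z :* D)) :* e := (con 1ℚ :+ x) :* e :+ z :* e :* D) refl
               (fromℕ (digit q₀ r₀)) (fromℕ q₀′ - fromℕ q₀) (fromℕ D) (E i j) ⟩
        (1ℚ + fromℕ (digit q₀ r₀)) * E i j + (fromℕ q₀′ - fromℕ q₀) * E i j * fromℕ D
          ≡⟨ cong (λ u → u * E i j + (fromℕ q₀′ - fromℕ q₀) * E i j * fromℕ D) (sym (fromℕ-+ 1 (digit q₀ r₀))) ⟩
        fromℕ (suc (digit q₀ r₀)) * E i j + (fromℕ q₀′ - fromℕ q₀) * E i j * fromℕ D ∎)

    module Resolution (n : ℕ) .{{n≢0 : ℕ.NonZero n}} where

      N : ℕ
      N = n ℕ.* D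

      instance
        N≢0 : ℕ.NonZero N
        N≢0 = ℕₚ.m*n≢0 n D

      iN : ℚ
      iN = invℕ N

      fromℕ-N : fromℕ N ≡ fromℕ n * fromℕ D
      fromℕ-N = fromℕ-* n D

      -- The resolution cancels against N = n D; this is why `Good` is one condition for all n.
      n*iN : fromℕ n * iN ≡ invℕ D
      n*iN = begin
        fromℕ n * iN                           ≡⟨ scaled⇒ D refl ⟩
        fromℕ D * (fromℕ n * iN) * invℕ D      ≡⟨ cong (_* invℕ D) (solve 3 (λ D n i → D :* (n :* i) := n :* D :* i) refl (fromℕ D) (fromℕ n) iN) ⟩
        fromℕ n * fromℕ D * iN * invℕ D        ≡⟨ cong (λ z → z * iN * invℕ D) (sym fromℕ-N) ⟩
        fromℕ N * iN * invℕ D                  ≡⟨ cong (_* invℕ D) (fromℕ*invℕ N) ⟩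
        1ℚ * invℕ D                            ≡⟨ *-identityˡ (invℕ D) ⟩
        invℕ D                                 ∎

      coord : ℚ → (Fin d → ℚ) → Fin (suc d) → Fin d → ℚ
      coord c τ i j = V zero j + sumFin (λ l → τ l * E l j) + c * e i j

      ratio : ℕ → ℚ
      ratio κ = fromℕ (suc κ) * iN

      base : Vec ℕ d → Fin d → ℚ
      base t l = fromℕ (lookup t l) * iN

      mini : Vec ℕ (suc d) → VertexTuple d
      mini (κ ∷ t) = tabulate (λ i → tabulate (coord (ratio κ) (base t) i))

      lookup-mini : ∀ κ t i j → lookup (lookup (mini (κ ∷ t)) i) j ≡ coord (ratio κ) (base t) i j
      lookup-mini κ t i j = trans (cong (λ z → lookup z j) (lookup∘tabulate (λ i → tabulate (coord (ratio κ) (base t) i)) i))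
        (lookup∘tabulate (coord (ratio κ) (base t) i) j)

      ratio-pos : ∀ κ → 0ℚ < ratio κ
      ratio-pos κ = *-pos (0<fromℕ (suc κ)) (invℕ-pos N)

      ratio-nonNeg : ∀ κ → 0ℚ ≤ ratio κ
      ratio-nonNeg κ = <⇒≤ (ratio-pos κ)

      base-nonNeg : ∀ t l → 0ℚ ≤ base t l
      base-nonNeg t l = *-nonNeg (0≤fromℕ (lookup t l)) (<⇒≤ (invℕ-pos N))

      total : ∀ κ t → sumFin (base t) + ratio κ ≡ fromℕ (suc (sumᵛ (κ ∷ t))) * iN
      total κ t = begin
        sumFin (base t) + ratio κ                      ≡⟨ cong (_+ ratio κ) (sum-*ʳ (λ l → fromℕ (lookup t l)) iN) ⟩
        sumFin (λ l → fromℕ (lookup t l)) * iN + ratio κ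
          ≡⟨ cong (λ z → z * iN + ratio κ) (sym (fromℕ-sumᵛ t)) ⟩
        fromℕ (sumᵛ t) * iN + fromℕ (suc κ) * iN       ≡⟨ solve 3 (λ a b i → a :* i :+ b :* i := (b :+ a) :* i) refl (fromℕ (sumᵛ t)) (fromℕ (suc κ)) iN ⟩
        (fromℕ (suc κ) + fromℕ (sumᵛ t)) * iN          ≡⟨ cong (_* iN) (sym (fromℕ-+ (suc κ) (sumᵛ t))) ⟩
        fromℕ (suc (sumᵛ (κ ∷ t))) * iN                ∎

      coord-zero : ∀ c τ j → coord c τ zero j ≡ V zero j + sumFin (λ l → τ l * E l j)
      coord-zero c τ j = solve 3 (λ v s c → v :+ s :+ c :* (v :- v) := v :+ s) refl (V zero j) (sumFin (λ l → τ l * E l j)) c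

      -- A point with weights `λs` on the miniature has barycentric coordinates base + c `λs` in P.
      -- The zeroth base weight `τ₀` is what k + Σ t leaves of N, divided by N; as the sum in the
      -- hypothesis counts k - 1, its strict bound says exactly that `τ₀` is nonnegative.
      mini-hull : ∀ κ t → sumᵛ (κ ∷ t) ℕ.< N → HullSubset (mini (κ ∷ t)) v
      mini-hull κ t sum<N x (λs , λs≥0 , Σλs≡1 , x≡) = μ , μ≥0 , Σμ≡1 , x≡′
        where
        c = ratio κ
        τ₀ : ℚ
        τ₀ = 1ℚ - (sumFin (base t) + c)
        μ : Fin (suc d) → ℚ
        μ zero    = τ₀ + c * λs zero
        μ (suc l) = base t l + c * λs (suc l)
        c*λ≥0 : ∀ i → 0ℚ ≤ c * λs i
        c*λ≥0 i = *-nonNeg (ratio-nonNeg κ) (λs≥0 i)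
        τ₀≥0 : 0ℚ ≤ τ₀
        τ₀≥0 = p≤q⇒0≤q-p (subst₂ _≤_ (sym (total κ t)) (fromℕ*invℕ N)
          (*-monoʳ-≤-nonNeg iN {{nonNegative (<⇒≤ (invℕ-pos N))}} (fromℕ-mono-≤ sum<N)))
        μ≥0 : ∀ i → 0ℚ ≤ μ i
        μ≥0 zero    = +-mono-≤ τ₀≥0 (c*λ≥0 zero)
        μ≥0 (suc l) = +-mono-≤ (base-nonNeg t l) (c*λ≥0 (suc l))
        λ₊ = λ l → λs (suc l)
        Σμ≡1 : sumFin μ ≡ 1ℚ
        Σμ≡1 = begin
          τ₀ + c * λs zero + sumFin (λ l → base t l + c * λs (suc l))
            ≡⟨ cong (τ₀ + c * λs zero +_) (trans (sum-+ (base t) (λ l → c * λs (suc l))) (cong (sumFin (base t) +_) (sum-*ˡ c λ₊))) ⟩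
          τ₀ + c * λs zero + (sumFin (base t) + c * sumFin λ₊)
            ≡⟨ solve 4 (λ b c x y → (con 1ℚ :- (b :+ c)) :+ c :* x :+ (b :+ c :* y) := con 1ℚ :- c :+ c :* (x :+ y)) refl
                 (sumFin (base t)) c (λs zero) (sumFin λ₊) ⟩
          1ℚ - c + c * sumFin λs
            ≡⟨ cong (λ z → 1ℚ - c + c * z) Σλs≡1 ⟩
          1ℚ - c + c * 1ℚ
            ≡⟨ solve 1 (λ c → con 1ℚ :- c :+ c :* con 1ℚ := con 1ℚ) refl c ⟩
          1ℚ ∎
        x≡′ : ∀ j → lookup x j ≡ sumFin (λ i → μ i * V i j)
        x≡′ j = begin
          lookup x j
            ≡⟨ x≡ j ⟩
          sumFin (λ i → λs i * lookup (lookup (mini (κ ∷ t)) i) j)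
            ≡⟨ sum-cong (λ i → cong (λs i *_) (trans (lookup-mini κ t i j)
                 (solve 4 (λ v s c w → v :+ s :+ c :* (w :- v) := (v :+ s :- c :* v) :+ c :* w) refl
                   (V zero j) b c (V i j)))) ⟩
          sumFin (λ i → λs i * ((V zero j + b - c * V zero j) + c * V i j))
            ≡⟨ affine-combination λs (λ i → V i j) (V zero j + b - c * V zero j) c ⟩
          (V zero j + b - c * V zero j) * sumFin λs + c * sumFin (λ i → λs i * V i j)
            ≡⟨ cong₂ (λ y z → (V zero j + b - c * V zero j) * y + c * z) Σλs≡1 (barycentric λs Σλs≡1 j) ⟩
          (V zero j + b - c * V zero j) * 1ℚ + c * (V zero j + s₊)
            ≡⟨ solve 4 (λ v b c s → (v :+ b :- c :* v) :* con 1ℚ :+ c :* (v :+ s) := v :+ (b :+ c :* s)) refl (V zero j) b c s₊ ⟩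
          V zero j + (b + c * s₊)
            ≡⟨ cong (V zero j +_) (sym combined) ⟩
          V zero j + sumFin (λ l → μ (suc l) * E l j)
            ≡⟨ sym (barycentric μ Σμ≡1 j) ⟩
          sumFin (λ i → μ i * V i j) ∎
          where
          b = sumFin (λ l → base t l * E l j)
          s₊ = sumFin (λ l → λs (suc l) * E l j)
          combined : sumFin (λ l → μ (suc l) * E l j) ≡ b + c * s₊
          combined = begin
            sumFin (λ l → (base t l + c * λs (suc l)) * E l j)
              ≡⟨ sum-cong (λ l → solve 4 (λ b c x e → (b :+ c :* x) :* e := b :* e :+ c :* (x :* e)) refl (base t l) c (λs (suc l)) (E l j)) ⟩
            sumFin (λ l → base t l * E l j + c * (λs (suc l) * E l j))
              ≡⟨ sum-+ (λ l → base t l * E l j) (λ l → c * (λs (suc l) * E l j)) ⟩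
            b + sumFin (λ l → c * (λs (suc l) * E l j))
              ≡⟨ cong (b +_) (sum-*ˡ c (λ l → λs (suc l) * E l j)) ⟩
            b + c * s₊ ∎

      n*base : ∀ t j → fromℕ n * sumFin (λ l → base t l * E l j) ≡ sumFin (λ l → fromℕ (lookup t l) * E l j) * invℕ D
      n*base t j = begin
        fromℕ n * sumFin (λ l → base t l * E l j)
          ≡⟨ cong (fromℕ n *_) (trans
               (sum-cong (λ l → solve 3 (λ t i e → t :* i :* e := t :* e :* i) refl (fromℕ (lookup t l)) iN (E l j)))
               (sum-*ʳ (λ l → fromℕ (lookup t l) * E l j) iN)) ⟩
        fromℕ n * (s * iN)       ≡⟨ solve 3 (λ n s i → n :* (s :* i) := s :* (n :* i)) refl (fromℕ n) s iN ⟩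
        s * (fromℕ n * iN)       ≡⟨ cong (s *_) n*iN ⟩
        s * invℕ D               ∎
        where s = sumFin (λ l → fromℕ (lookup t l) * E l j)

      n*ratio : ∀ κ x → fromℕ n * (ratio κ * x) ≡ fromℕ (suc κ) * x * invℕ D
      n*ratio κ x = trans (solve 4 (λ n k i x → n :* (k :* i :* x) := k :* x :* (n :* i)) refl (fromℕ n) (fromℕ (suc κ)) iN x)
        (cong (fromℕ (suc κ) * x *_) n*iN)

      mini-grid : ∀ κ t → Good (κ ∷ t) → ∀ i j → OnGrid n (coord (ratio κ) (base t) i j)
      mini-grid κ t (good₁ , good₂) i j = subst IsInteger (sym expand)
        (int-+ (int-+ (int-* (int-fromℕ n) (V-int zero j)) (subst IsInteger (sym (n*base t j)) (good₁ j))) (edge i))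
        where
        expand : fromℕ n * coord (ratio κ) (base t) i j
          ≡ fromℕ n * V zero j + fromℕ n * sumFin (λ l → base t l * E l j) + fromℕ n * (ratio κ * e i j)
        expand = solve 4 (λ n v s x → n :* (v :+ s :+ x) := n :* v :+ n :* s :+ n :* x) refl
          (fromℕ n) (V zero j) (sumFin (λ l → base t l * E l j)) (ratio κ * e i j)
        edge : ∀ i → IsInteger (fromℕ n * (ratio κ * e i j))
        edge zero    = subst IsInteger
          (solve 3 (λ n r v → con 0ℚ := n :* (r :* (v :- v))) refl (fromℕ n) (ratio κ) (V zero j)) (int-fromℕ 0)
        edge (suc i) = subst IsInteger (sym (n*ratio κ (E i j))) (good₂ i j)

      mini-HorMin : ∀ p → sumᵛ p ℕ.< N → Good p → HorMin n v (mini p)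
      mini-HorMin (κ ∷ t) sum<N good =
          (ratio κ , tabulate (λ j → coord (ratio κ) (base t) zero j - ratio κ * V zero j) , ratio-pos κ , homothety)
        , mini-hull κ t sum<N
        , (λ i j → subst (OnGrid n) (sym (lookup-mini κ t i j)) (mini-grid κ t good i j))
        where
        homothety : ∀ i j → _
        homothety i j = trans (lookup-mini κ t i j) (trans
          (solve 4 (λ v s c w → v :+ s :+ c :* (w :- v) := c :* w :+ (v :+ s :+ c :* (v :- v) :- c :* v)) refl
            (V zero j) (sumFin (λ l → base t l * E l j)) (ratio κ) (V i j))
          (cong (ratio κ * V i j +_) (sym (lookup∘tabulate (λ j → coord (ratio κ) (base t) zero j - ratio κ * V zero j) j))))

      -- The zeroth vertex determines t because the edges are independent; the first edge, which
      -- exists in positive dimension, then determines the ratio.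
      mini-injective : ∀ {p p′} → mini p ≡ mini p′ → p ≡ p′
      mini-injective {κ ∷ t} {κ′ ∷ t′} eq = cong₂ _∷_ κ≡κ′ (vec-ext t≡t′)
        where
        coords : ∀ i j → coord (ratio κ) (base t) i j ≡ coord (ratio κ′) (base t′) i j
        coords i j = trans (sym (lookup-mini κ t i j)) (trans (cong (λ w → lookup (lookup w i) j) eq) (lookup-mini κ′ t′ i j))
        sums : ∀ j → sumFin (λ l → base t l * E l j) ≡ sumFin (λ l → base t′ l * E l j)
        sums j = +-cancelˡ (V zero j) (trans (sym (coord-zero (ratio κ) (base t) j)) (trans (coords zero j) (coord-zero (ratio κ′) (base t′) j)))
          where open import Algebra.Properties.Group +-0-group using () renaming (∙-cancelˡ to cancelˡ)
                +-cancelˡ = λ x {y} {z} → cancelˡ x y z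
        t≡t′ : ∀ l → lookup t l ≡ lookup t′ l
        t≡t′ l = fromℕ-injective (invℕ-scaled-cancel N (E-independent (base t) (base t′) sums l))
        edges : ∀ j → ratio κ * E zero j ≡ ratio κ′ * E zero j
        edges j = trans (sym (diff (ratio κ) (sumFin (λ l → base t l * E l j))))
          (trans (cong₂ _-_ (coords (suc zero) j) (cong (V zero j +_) (sums j))) (diff (ratio κ′) (sumFin (λ l → base t′ l * E l j))))
          where
          diff : ∀ c s → V zero j + s + c * E zero j - (V zero j + s) ≡ c * E zero j
          diff c s = solve 4 (λ v s c x → v :+ s :+ c :* x :- (v :+ s) := c :* x) refl (V zero j) s c (E zero j)
        κ≡κ′ : κ ≡ κ′
        κ≡κ′ = ℕₚ.suc-injective (fromℕ-injective (invℕ-scaled-cancel N (begin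
          ratio κ           ≡⟨ sym (*-identityʳ (ratio κ)) ⟩
          ratio κ * 1ℚ      ≡⟨ E-independent (λ l → ratio κ * δ l zero) (λ l → ratio κ′ * δ l zero)
                                 (λ j → trans (single (ratio κ) zero j) (trans (edges j) (sym (single (ratio κ′) zero j)))) zero ⟩
          ratio κ′ * 1ℚ     ≡⟨ *-identityʳ (ratio κ′) ⟩
          ratio κ′          ∎)))

      -- Two vertices carry all the inequalities: the zeroth lies in P and gives t ≥ 0, the next one
      -- gives k + Σ t ≤ N. Integrality of N τ and N c comes from the grid condition on the zeroth
      -- vertex and on differences of vertices.
      HorMin⇒mini : ∀ w → HorMin n v w → ∃ λ p → sumᵛ p ℕ.< N × Good p × w ≡ mini p
      HorMin⇒mini w ((c , a , 0<c , hom) , hull , grid) = conclude (nonNeg-int Nc-int Nc≥0) (λ l → nonNeg-int (Nλ-int l) (Nλ≥0 l))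
        where
        W : Fin (suc d) → Fin d → ℚ
        W i j = lookup (lookup w i) j
        vertex∈hull : ∀ i → InHull w (lookup w i)
        vertex∈hull i = (λ l → δ l i) , δ≥0 i , trans (sum-cong (λ l → sym (*-identityˡ (δ l i)))) (sum-δ (λ _ → 1ℚ) i)
                      , λ j → sym (trans (sum-cong (λ l → *-comm (δ l i) (W l j))) (sum-δ (λ l → W l j) i))
          where
          δ≥0 : ∀ {m} (i : Fin m) l → 0ℚ ≤ δ l i
          δ≥0 zero    zero    = 0≤fromℕ 1
          δ≥0 zero    (suc l) = ≤-refl
          δ≥0 (suc i) zero    = ≤-refl
          δ≥0 (suc i) (suc l) = δ≥0 i l
        hull₀ = hull (lookup w zero) (vertex∈hull zero)
        hull₁ = hull (lookup w (suc zero)) (vertex∈hull (suc zero))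
        λ₀ λ₁ : Fin (suc d) → ℚ
        λ₀ = proj₁ hull₀
        λ₁ = proj₁ hull₁
        λ₀≥0 = proj₁ (proj₂ hull₀)
        λ₁≥0 = proj₁ (proj₂ hull₁)
        Σλ₀ = proj₁ (proj₂ (proj₂ hull₀))
        Σλ₁ = proj₁ (proj₂ (proj₂ hull₁))
        τ : Fin d → ℚ
        τ l = λ₀ (suc l)
        W₀ : ∀ j → W zero j ≡ V zero j + sumFin (λ l → τ l * E l j)
        W₀ j = trans (proj₂ (proj₂ (proj₂ hull₀)) j) (barycentric λ₀ Σλ₀ j)
        W₁ : ∀ j → W (suc zero) j ≡ V zero j + sumFin (λ l → λ₁ (suc l) * E l j)
        W₁ j = trans (proj₂ (proj₂ (proj₂ hull₁)) j) (barycentric λ₁ Σλ₁ j)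
        W-edge : ∀ i j → W i j ≡ W zero j + c * e i j
        W-edge i j = trans (hom i j) (trans
          (solve 4 (λ c x a y → c :* x :+ a := c :* y :+ a :+ c :* (x :- y)) refl c (V i j) (lookup a j) (V zero j))
          (cong (_+ c * e i j) (sym (hom zero j))))
        W-coord : ∀ i j → W i j ≡ coord c τ i j
        W-coord i j = trans (W-edge i j) (cong (_+ c * e i j) (W₀ j))
        -- The first vertex is the zeroth one moved by c along the first edge, so its zeroth
        -- barycentric coordinate is λ₀ zero - c, and it is nonnegative.
        λ₁≡ : ∀ l → τ l + c * δ l zero ≡ λ₁ (suc l)
        λ₁≡ = E-independent _ _ (λ j → begin
          sumFin (λ l → (τ l + c * δ l zero) * E l j)
            ≡⟨ sum-cong (λ l → *-distribʳ-+ (E l j) (τ l) (c * δ l zero)) ⟩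
          sumFin (λ l → τ l * E l j + c * δ l zero * E l j)
            ≡⟨ trans (sum-+ (λ l → τ l * E l j) (λ l → c * δ l zero * E l j)) (cong (sumFin (λ l → τ l * E l j) +_) (single c zero j)) ⟩
          sumFin (λ l → τ l * E l j) + c * E zero j
            ≡⟨ solve 3 (λ v s x → s :+ x := v :+ s :+ x :- v) refl (V zero j) (sumFin (λ l → τ l * E l j)) (c * E zero j) ⟩
          coord c τ (suc zero) j - V zero j
            ≡⟨ cong (_- V zero j) (trans (sym (W-coord (suc zero) j)) (W₁ j)) ⟩
          V zero j + sumFin (λ l → λ₁ (suc l) * E l j) - V zero j
            ≡⟨ solve 2 (λ v s → v :+ s :- v := s) refl (V zero j) (sumFin (λ l → λ₁ (suc l) * E l j)) ⟩
          sumFin (λ l → λ₁ (suc l) * E l j) ∎)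
        Στ+c≤1 : sumFin τ + c ≤ 1ℚ
        Στ+c≤1 = 0≤q-p⇒p≤q (subst (0ℚ ≤_) (sym slack) (λ₁≥0 zero))
          where
          moved : sumFin (λ l → λ₁ (suc l)) ≡ sumFin τ + c
          moved = begin
            sumFin (λ l → λ₁ (suc l))               ≡⟨ sum-cong (λ l → sym (λ₁≡ l)) ⟩
            sumFin (λ l → τ l + c * δ l zero)       ≡⟨ sum-+ τ (λ (l : Fin d) → c * δ l zero) ⟩
            sumFin τ + sumFin (λ (l : Fin d) → c * δ l zero)  ≡⟨ cong (sumFin τ +_) (sum-δ {d} (λ _ → c) zero) ⟩
            sumFin τ + c                            ∎
          slack : 1ℚ - (sumFin τ + c) ≡ λ₁ zero
          slack = begin
            1ℚ - (sumFin τ + c)                        ≡⟨ cong₂ _-_ (sym Σλ₁) (sym moved) ⟩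
            sumFin λ₁ - sumFin (λ l → λ₁ (suc l))      ≡⟨ solve 2 (λ x s → x :+ s :- s := x) refl (λ₁ zero) (sumFin (λ l → λ₁ (suc l))) ⟩
            λ₁ zero                                    ∎
        pull-n : (f : Fin d → ℚ) → ∀ j → sumFin (λ l → fromℕ n * f l * E l j) ≡ fromℕ n * sumFin (λ l → f l * E l j)
        pull-n f j = trans (sum-cong (λ l → *-assoc (fromℕ n) (f l) (E l j))) (sum-*ˡ (fromℕ n) (λ l → f l * E l j))
        N-scaled : ∀ (f : Fin d → ℚ) → (∀ j → IsInteger (fromℕ n * sumFin (λ l → f l * E l j))) → ∀ l → IsInteger (fromℕ N * f l)
        N-scaled f h l = subst IsInteger
          (trans (solve 3 (λ D n f → D :* (n :* f) := n :* D :* f) refl (fromℕ D) (fromℕ n) (f l)) (cong (_* f l) (sym fromℕ-N)))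
          (recover-int (λ l → fromℕ n * f l) (λ j → subst IsInteger (sym (pull-n f j)) (h j)) l)
        nτE-int : ∀ j → IsInteger (fromℕ n * sumFin (λ l → τ l * E l j))
        nτE-int j = subst IsInteger
          (trans (cong (λ z → fromℕ n * z - fromℕ n * V zero j) (W₀ j))
            (solve 3 (λ n v s → n :* (v :+ s) :- n :* v := n :* s) refl (fromℕ n) (V zero j) (sumFin (λ l → τ l * E l j))))
          (int-sub (grid zero j) (int-* (int-fromℕ n) (V-int zero j)))
        ncE-int : ∀ i j → IsInteger (fromℕ n * (c * E i j))
        ncE-int i j = subst IsInteger
          (trans (cong (λ z → fromℕ n * z - fromℕ n * W zero j) (W-edge (suc i) j))
            (solve 3 (λ n v s → n :* (v :+ s) :- n :* v := n :* s) refl (fromℕ n) (W zero j) (c * E i j)))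
          (int-sub (grid (suc i) j) (grid zero j))
        Nλ-int : ∀ l → IsInteger (fromℕ N * τ l)
        Nλ-int = N-scaled τ nτE-int
        Nc-int : IsInteger (fromℕ N * c)
        Nc-int = subst IsInteger (cong (fromℕ N *_) (*-identityʳ c))
          (N-scaled (λ l → c * δ l zero) (λ j → subst IsInteger (cong (fromℕ n *_) (sym (single c zero j))) (ncE-int zero j)) zero)
        Nλ≥0 : ∀ l → 0ℚ ≤ fromℕ N * τ l
        Nλ≥0 l = *-nonNeg (0≤fromℕ N) (λ₀≥0 (suc l))
        Nc≥0 : 0ℚ ≤ fromℕ N * c
        Nc≥0 = *-nonNeg (0≤fromℕ N) (<⇒≤ 0<c)
        conclude : (∃ λ k → fromℕ N * c ≡ fromℕ k) → (∀ l → ∃ λ k → fromℕ N * τ l ≡ fromℕ k) →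
                   ∃ λ p → sumᵛ p ℕ.< N × Good p × w ≡ mini p
        -- k = 0 contradicts c > 0; hence k has a predecessor to serve as `κ`.
        conclude (zero , Nc≡) _ = contradiction Nc≡ (λ eq → <-irrefl (sym eq) (*-pos (0<fromℕ N) 0<c))
        conclude (suc κ , Nc≡) Nτ = κ ∷ t , sum<N , (good₁ , good₂) , vec-ext (λ i → vec-ext (λ j → trans (W-coord i j) (trans (coord≡ i j) (sym (lookup-mini κ t i j)))))
          where
          t : Vec ℕ d
          t = tabulate (λ l → proj₁ (Nτ l))
          τ≡ : ∀ l → τ l ≡ base t l
          τ≡ l = trans (scaled⇒ N (proj₂ (Nτ l))) (cong (λ z → fromℕ z * iN) (sym (lookup∘tabulate (λ l → proj₁ (Nτ l)) l)))
          c≡ : c ≡ ratio κ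
          c≡ = scaled⇒ N Nc≡
          τE≡ : ∀ j → sumFin (λ l → τ l * E l j) ≡ sumFin (λ l → base t l * E l j)
          τE≡ j = sum-cong (λ l → cong (_* E l j) (τ≡ l))
          coord≡ : ∀ i j → coord c τ i j ≡ coord (ratio κ) (base t) i j
          coord≡ i j = cong₂ (λ x y → V zero j + x + y * e i j) (τE≡ j) c≡
          good₁ = λ j → subst IsInteger (trans (cong (fromℕ n *_) (τE≡ j)) (n*base t j)) (nτE-int j)
          good₂ = λ i j → subst IsInteger (trans (cong (λ z → fromℕ n * (z * E i j)) c≡) (n*ratio κ (E i j))) (ncE-int i j)
          sum<N : sumᵛ (κ ∷ t) ℕ.< N
          sum<N = fromℕ-cancel-≤ {suc (sumᵛ (κ ∷ t))} {N} (*-cancelʳ-≤-pos iN {{positive (invℕ-pos N)}}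
            (subst₂ _≤_ (trans (cong₂ _+_ (sum-cong τ≡) c≡) (total κ t)) (sym (fromℕ*invℕ N)) Στ+c≤1))

      -- The volume of P scaled by 1/N. In this unit the volumes of P and of its miniatures are d-th
      -- powers of natural numbers, N^d and k^d.
      unitVol : ℚ
      unitVol = ∣ det (λ i j → iN * E i j) ∣ * invℕ (d ℕ.!)

      unitVol≥0 : 0ℚ ≤ unitVol
      unitVol≥0 = *-nonNeg (0≤∣p∣ (det (λ i j → iN * E i j))) (<⇒≤ (invℕ-pos (d ℕ.!) {{d ℕₚ.!≢0}}))

      vol-scaled : ∀ (u : VertexTuple d) k → (∀ i j → edgeMatrix u i j ≡ fromℕ k * (iN * E i j)) →
                   vol u ≡ fromℕ (k ℕ.^ d) * unitVol
      vol-scaled u k h = begin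
        ∣ det (edgeMatrix u) ∣ * invℕ (d ℕ.!)
          ≡⟨ cong (λ z → ∣ z ∣ * invℕ (d ℕ.!)) (trans (det-cong h) (det-scale k (λ i j → iN * E i j))) ⟩
        ∣ fromℕ (k ℕ.^ d) * D₁ ∣ * invℕ (d ℕ.!)
          ≡⟨ cong (_* invℕ (d ℕ.!)) (trans (∣p*q∣≡∣p∣*∣q∣ (fromℕ (k ℕ.^ d)) D₁)
               (cong (_* ∣ D₁ ∣) (0≤p⇒∣p∣≡p (0≤fromℕ (k ℕ.^ d))))) ⟩
        fromℕ (k ℕ.^ d) * ∣ D₁ ∣ * invℕ (d ℕ.!)
          ≡⟨ *-assoc (fromℕ (k ℕ.^ d)) ∣ D₁ ∣ (invℕ (d ℕ.!)) ⟩
        fromℕ (k ℕ.^ d) * unitVol ∎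
        where D₁ = det (λ i j → iN * E i j)

      vol-v : vol v ≡ fromℕ (N ℕ.^ d) * unitVol
      vol-v = vol-scaled v N (λ i j → begin
        E i j                      ≡⟨ sym (*-identityˡ (E i j)) ⟩
        1ℚ * E i j                 ≡⟨ cong (_* E i j) (sym (fromℕ*invℕ N)) ⟩
        fromℕ N * iN * E i j       ≡⟨ *-assoc (fromℕ N) iN (E i j) ⟩
        fromℕ N * (iN * E i j)     ∎)

      vol-mini : ∀ p → vol (mini p) ≡ fromℕ (weight p) * unitVol
      vol-mini (κ ∷ t) = vol-scaled (mini (κ ∷ t)) (suc κ) (λ i j → begin
        edgeMatrix (mini (κ ∷ t)) i j
          ≡⟨ cong₂ _-_ (lookup-mini κ t (suc i) j) (lookup-mini κ t zero j) ⟩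
        coord (ratio κ) (base t) (suc i) j - coord (ratio κ) (base t) zero j
          ≡⟨ solve 5 (λ v s k i w → v :+ s :+ k :* i :* (w :- v) :- (v :+ s :+ k :* i :* (v :- v)) := k :* (i :* (w :- v))) refl
               (V zero j) (sumFin (λ l → base t l * E l j)) (fromℕ (suc κ)) iN (V (suc i) j) ⟩
        fromℕ (suc κ) * (iN * E i j) ∎)

-- The average volume and its limit.

module Averages where

  open Rationals
  open Determinants
  open Miniatures
  open Counting using (sumBy; ∈Δ⇒sum≤; sum≤⇒∈Δ; Δ)
  open import Data.Nat as ℕ using (ℕ; zero; suc)
  import Data.Nat.Properties as ℕₚ
  open import Data.Nat.Combinatorics using (_C_)
  open import Data.Integer as ℤ using (-[1+_])
  import Data.Integer.Properties as ℤₚ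
  open import Data.Fin using (Fin; zero; suc)
  open import Data.Rational
  open import Data.Rational.Properties
  open import Data.Rational.Solver using (module +-*-Solver)
  open import Data.Vec using (Vec; []; _∷_; lookup; replicate) renaming (sum to sumᵛ)
  open import Data.Vec.Properties using (lookup-replicate)
  open import Data.List using (List; []; _∷_; map; length)
  open import Data.List.Properties using (length-map)
  open import Data.List.Membership.Propositional using (_∈_)
  open import Data.List.Membership.Propositional.Properties using (∈-map⁺; ∈-map⁻; ∈-filter⁺; ∈-filter⁻)
  open import Data.List.Membership.Propositional.Properties.WithK using (unique∧set⇒bag)
  open import Data.List.Relation.Unary.Any using (here; there)
  open import Data.List.Relation.Unary.All using ([]; _∷_)
  open import Data.List.Relation.Unary.AllPairs using ([]; _∷_)
  import Data.List.Relation.Unary.Unique.Propositional.Properties as Uniqueₚ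
  open import Data.List.Relation.Binary.BagAndSetEquality using (∼bag⇒↭)
  open import Data.List.Relation.Binary.Permutation.Propositional using (_↭_; prep; swap) renaming (refl to ↭refl; trans to ↭trans)
  open import Data.List.Relation.Binary.Permutation.Propositional.Properties using (↭-length)
  open import Data.Product using (_,_; ∃; proj₁; proj₂)
  open import Data.Sum using (inj₁; inj₂)
  open import Function.Bundles using (mk⇔; Equivalence)
  open import Relation.Nullary using (contradiction)
  open import Relation.Binary.PropositionalEquality
  open +-*-Solver using (solve; _:=_; _:+_; _:*_; :-_; _:-_; con)

  sumVol-↭ : ∀ {d} {L L′ : List (VertexTuple d)} → L ↭ L′ → sumVol L ≡ sumVol L′
  sumVol-↭ ↭refl        = refl
  sumVol-↭ (prep w p)   = cong (vol w +_) (sumVol-↭ p)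
  sumVol-↭ (swap {xs} {ys} w u p) = trans (cong (λ z → vol w + (vol u + z)) (sumVol-↭ p))
    (solve 3 (λ a b c → a :+ (b :+ c) := b :+ (a :+ c)) refl (vol w) (vol u) (sumVol ys))
  sumVol-↭ (↭trans p q) = trans (sumVol-↭ p) (sumVol-↭ q)

  HorMin-refl : ∀ {d} n (v : VertexTuple d) → (∀ i j → IsInteger (lookup (lookup v i) j)) → HorMin n v v
  HorMin-refl n v V-int =
      (1ℚ , replicate _ 0ℚ , 0<fromℕ 1 , λ i j → trans
         (solve 1 (λ x → x := con 1ℚ :* x :+ con 0ℚ) refl (lookup (lookup v i) j))
         (cong (1ℚ * lookup (lookup v i) j +_) (sym (lookup-replicate j 0ℚ))))
    , (λ x h → h)
    , λ i j → int-* (int-fromℕ n) (V-int i j)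

  q<1+∣↥q∣ : ∀ q → q < fromℕ (suc ℤ.∣ ↥ q ∣)
  q<1+∣↥q∣ q@(mkℚ z k _) = ≤-<-trans q≤ (subst₂ _<_ (+-identityˡ _) (sym (fromℕ-+ 1 ℤ.∣ z ∣))
    (+-monoˡ-< (fromℕ ℤ.∣ z ∣) (0<fromℕ 1)))
    where
    bound : ∀ z → z ℤ.* ℤ.+ 1 ℤ.≤ ℤ.+ ℤ.∣ z ∣ ℤ.* ℤ.+ suc k
    bound (ℤ.+ m)  = ℤₚ.*-monoˡ-≤-nonNeg (ℤ.+ m) (ℤ.+≤+ (ℕ.s≤s ℕ.z≤n))
    bound -[1+ m ] = ℤ.-≤+
    q≤ : q ≤ fromℕ ℤ.∣ z ∣
    q≤ = subst (q ≤_) (sym (fromℤ-mkℚ (ℤ.+ ℤ.∣ z ∣))) (*≤* (bound z))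

  archimedean : ∀ p ε → 0ℚ < ε → ∃ λ Y → p < ε * fromℕ Y
  archimedean p ε 0<ε = Y , subst₂ _<_ p≡ (*-comm (fromℕ Y) ε) (*-monoˡ-<-pos ε {{positive 0<ε}} (q<1+∣↥q∣ q))
    where
    instance ε≢0 = >-nonZero 0<ε
    q = p * (1/ ε)
    Y = suc ℤ.∣ ↥ q ∣
    p≡ : q * ε ≡ p
    p≡ = trans (*-assoc p (1/ ε) ε) (trans (cong (p *_) (*-inverseˡ ε)) (*-identityʳ p))

  -- The integer inequality is multiplied by u / (b c). The symmetric form serves the upper and the
  -- lower bound, with (p , c) and (q , b) exchanged.
  clear-denominators : ∀ {u} → 0ℚ ≤ u → ∀ p q c b .{{_ : ℕ.NonZero c}} .{{_ : ℕ.NonZero b}} y z →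
    p ℕ.* b ℕ.* y ℕ.≤ q ℕ.* c ℕ.* z → fromℕ p * u * invℕ c * fromℕ y ≤ fromℕ q * u * invℕ b * fromℕ z
  clear-denominators {u} 0≤u p q c b y z h = subst₂ _≤_
    (trans (cong (u * invℕ c * invℕ b *_) (triple p b y)) (trans
      (solve 6 (λ u i j p b y → u :* i :* j :* (p :* b :* y) := p :* u :* i :* y :* (b :* j)) refl u (invℕ c) (invℕ b) (fromℕ p) (fromℕ b) (fromℕ y))
      (cancel b)))
    (trans (cong (u * invℕ c * invℕ b *_) (triple q c z)) (trans
      (solve 6 (λ u i j q c z → u :* i :* j :* (q :* c :* z) := q :* u :* j :* z :* (c :* i)) refl u (invℕ c) (invℕ b) (fromℕ q) (fromℕ c) (fromℕ z))
      (cancel c)))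
    (*-monoˡ-≤-nonNeg (u * invℕ c * invℕ b) {{nonNegative (*-nonNeg (*-nonNeg 0≤u (<⇒≤ (invℕ-pos c))) (<⇒≤ (invℕ-pos b)))}}
      (fromℕ-mono-≤ h))
    where
    triple : ∀ a b c → fromℕ (a ℕ.* b ℕ.* c) ≡ fromℕ a * fromℕ b * fromℕ c
    triple a b c = trans (fromℕ-* (a ℕ.* b) c) (cong (_* fromℕ c) (fromℕ-* a b))
    cancel : ∀ {x} k .{{_ : ℕ.NonZero k}} → x * (fromℕ k * invℕ k) ≡ x
    cancel {x} k = trans (cong (x *_) (fromℕ*invℕ k)) (*-identityʳ x)

  -- The error is measured against t, which stays fixed as n grows. The upper bound gives (x - t) y
  -- ≤ t M directly; the lower one gives (t - x) y ≤ x M, and x ≤ t replaces x by t.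
  close : ∀ {x t y M} → 0ℚ ≤ t → 0ℚ ≤ y → 0ℚ ≤ M →
    x * y ≤ t * (y + M) → t * y ≤ x * (y + M) → ∣ x - t ∣ * y ≤ t * M
  close {x} {t} {y} {M} 0≤t 0≤y 0≤M upper lower with ∣p∣≡p∨∣p∣≡-p (x - t)
  ... | inj₁ e = subst (λ z → z * y ≤ t * M) (sym e) (subst₂ _≤_
    (solve 3 (λ x t y → x :* y :+ :- (t :* y) := (x :- t) :* y) refl x t y)
    (solve 3 (λ t y M → t :* (y :+ M) :+ :- (t :* y) := t :* M) refl t y M)
    (+-monoˡ-≤ (- (t * y)) upper))
  ... | inj₂ e with ≤-total x t
  ... | inj₁ x≤t = subst (λ z → z * y ≤ t * M) (sym e) (subst₂ _≤_
    (solve 3 (λ x t y → t :* y :+ :- (x :* y) := :- (x :- t) :* y) refl x t y)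
    refl
    (≤-trans (+-monoˡ-≤ (- (x * y)) lower) (subst (_≤ t * M)
      (solve 3 (λ x y M → x :* M := x :* (y :+ M) :+ :- (x :* y)) refl x y M)
      (*-monoʳ-≤-nonNeg M {{nonNegative 0≤M}} x≤t))))
  -- Here the absolute value is -(x - t) although x - t is nonnegative, so the left side is at most
  -- 0.
  ... | inj₂ t≤x = subst (λ z → z * y ≤ t * M) (sym e) (≤-trans
    (subst₂ _≤_ (solve 3 (λ x t y → :- ((x :- t) :* y) := :- (x :- t) :* y) refl x t y) refl
      (neg-antimono-≤ (*-nonNeg (p≤q⇒0≤q-p t≤x) 0≤y)))
    (*-nonNeg 0≤t 0≤M))

  module Dimension≥1 {d′ : ℕ} (v : VertexTuple (suc d′))
    (V-int : ∀ i j → IsInteger (lookup (lookup v i) j)) (inv : IntegralInverse (edgeMatrix v)) where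

    open Simplex v V-int inv

    module _ (n : ℕ) .{{n≢0 : ℕ.NonZero n}} where

      open Resolution n

      minis : List (VertexTuple d)
      minis = map mini (points n)

      minis-sound : ∀ {w} → w ∈ minis → HorMin n v w
      minis-sound w∈ with ∈-map⁻ mini w∈
      ... | p , p∈ , refl with ∈-filter⁻ good? {xs = Δ (suc d) (N ℕ.∸ 1)} p∈
      ... | p∈Δ , good = mini-HorMin p
        (ℕₚ.≤-trans (ℕ.s≤s (∈Δ⇒sum≤ (suc d) (N ℕ.∸ 1) p∈Δ)) (ℕₚ.≤-reflexive (ℕₚ.suc-pred N))) good

      mini∈minis : ∀ p → sumᵛ p ℕ.< N → Good p → mini p ∈ minis
      mini∈minis p sum<N good = ∈-map⁺ mini (∈-filter⁺ good?
        (sum≤⇒∈Δ (suc d) (N ℕ.∸ 1) p (ℕₚ.<⇒≤pred sum<N)) good)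

      minis-complete : ∀ {w} → HorMin n v w → w ∈ minis
      minis-complete {w} h = let p , sum<N , good , w≡ = HorMin⇒mini w h in
        subst (_∈ minis) (sym w≡) (mini∈minis p sum<N good)

      minis-enumerates : Enumerates n v minis
      minis-enumerates = Uniqueₚ.map⁺ mini-injective (points-unique periodic n) , λ w → mk⇔ minis-sound minis-complete

      module _ (L : List (VertexTuple d)) (enum : Enumerates n v L) where

        -- Two lists without repetition and with the same members are permutations of each other, so
        -- any enumeration may be replaced by `minis`.
        L↭minis : L ↭ minis
        L↭minis = ∼bag⇒↭ (unique∧set⇒bag (proj₁ enum) (proj₁ minis-enumerates)
          (λ {w} → mk⇔ (λ w∈L → minis-complete (Equivalence.to (proj₂ enum w) w∈L))
                       (λ w∈M → Equivalence.from (proj₂ enum w) (minis-sound w∈M))))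

        length-L : length L ≡ length (points n)
        length-L = trans (↭-length L↭minis) (length-map mini (points n))

        sumVol-L : sumVol L ≡ fromℕ (sumBy weight (points n)) * unitVol
        sumVol-L = trans (sumVol-↭ L↭minis) (go (points n))
          where
          go : ∀ ps → sumVol (map mini ps) ≡ fromℕ (sumBy weight ps) * unitVol
          go []       = sym (*-zeroˡ unitVol)
          go (p ∷ ps) = trans (cong₂ _+_ (vol-mini p) (go ps)) (trans
            (sym (*-distribʳ-+ unitVol (fromℕ (weight p)) (fromℕ (sumBy weight ps))))
            (cong (_* unitVol) (sym (fromℕ-+ (weight p) (sumBy weight ps)))))

        -- `v` is its own miniature, so the denominator of the average is not 0 and `invℕ` is a true
        -- inverse there.
        count≢0 : ℕ.NonZero (length (points n))
        count≢0 = subst ℕ.NonZero length-L (nonempty (Equivalence.from (proj₂ enum v) (HorMin-refl n v V-int)))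
          where
          nonempty : ∀ {K : List (VertexTuple d)} → v ∈ K → ℕ.NonZero (length K)
          nonempty (here _)  = _
          nonempty (there _) = _

        avgVol-L : avgVol L ≡ fromℕ (sumBy weight (points n)) * unitVol * invℕ (length (points n))
        avgVol-L = cong₂ (λ x y → x * invℕ y) sumVol-L length-L

    β : ℕ
    β = (2 ℕ.* d ℕ.+ 1) C d

    β≢0 : ℕ.NonZero β
    β≢0 = ℕₚ.m*n≢0⇒m≢0 β {{subst ℕ.NonZero (sym (Counting.binomial-factorial d)) ((2 ℕ.* d ℕ.+ 1) ℕₚ.!≢0)}}

    -- The product K s of `Estimate`, the total subtracted in Bernoulli's inequality; it depends on
    -- d alone.
    M : ℕ
    M = suc (d ℕ.+ d) ℕ.* (4 ℕ.* d)

    estimate : ∀ m y → y ℕ.+ M ≡ suc m ℕ.+ 4 ℕ.* d → ∀ L → Enumerates (suc m ℕ.+ 2 ℕ.* d) v L →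
               ∣ avgVol L - muTarget v ∣ * fromℕ y ≤ muTarget v * fromℕ M
    estimate m y y+M≡b L enum = close {avgVol L} {muTarget v} {fromℕ y} {fromℕ M} target≥0 (0≤fromℕ y) (0≤fromℕ M) upper lower
      where
      open Estimate periodic m y using (n; S; count; average-upper; average-lower)
      open Resolution n using (N; unitVol; unitVol≥0; vol-v)
      instance
        _ = count≢0 n L enum
        _ = β≢0
      target : muTarget v ≡ fromℕ (N ℕ.^ d) * unitVol * invℕ β
      target = cong (_* invℕ β) vol-v
      target≥0 : 0ℚ ≤ muTarget v
      target≥0 = subst (0ℚ ≤_) (sym target) (*-nonNeg (*-nonNeg (0≤fromℕ (N ℕ.^ d)) unitVol≥0) (<⇒≤ (invℕ-pos β)))
      upper : avgVol L * fromℕ y ≤ muTarget v * (fromℕ y + fromℕ M)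
      upper = subst₂ _≤_ (cong (_* fromℕ y) (sym (avgVol-L n L enum))) (cong₂ _*_ (sym target) (fromℕ-+ y M))
        (clear-denominators unitVol≥0 S (N ℕ.^ d) count β y (y ℕ.+ M) (average-upper y+M≡b))
      lower : muTarget v * fromℕ y ≤ avgVol L * (fromℕ y + fromℕ M)
      lower = subst₂ _≤_ (cong (_* fromℕ y) (sym target)) (cong₂ _*_ (sym (avgVol-L n L enum)) (fromℕ-+ y M))
        (clear-denominators unitVol≥0 (N ℕ.^ d) S β count y (y ℕ.+ M) (average-lower y+M≡b))

    converges : ∀ ε Y → 0ℚ < ε → muTarget v * fromℕ M < ε * fromℕ Y →
      ∀ n → Y ℕ.+ M ℕ.+ suc (2 ℕ.* d) ℕ.≤ n → ∀ L → Enumerates n v L → ∣ avgVol L - muTarget v ∣ < ε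
    converges ε Y 0<ε TM<εY n N₀≤n L enum = *-cancelʳ-<-nonNeg (fromℕ y) {{nonNegative (0≤fromℕ y)}}
      (≤-<-trans (estimate m y y+M≡ L (subst (λ k → Enumerates k v L) (sym n≡) enum))
        (<-≤-trans TM<εY (*-monoˡ-≤-nonNeg ε {{nonNegative (<⇒≤ 0<ε)}} (fromℕ-mono-≤ {Y} {y} Y≤y))))
      where
      -- `m` inverts n = m + 1 + 2d, and `y` solves y + M = n + 2d = b. The threshold on n makes
      -- both subtractions exact and gives Y ≤ y.
      m = n ℕ.∸ suc (2 ℕ.* d)
      y = n ℕ.+ 2 ℕ.* d ℕ.∸ M
      n≡ : suc m ℕ.+ 2 ℕ.* d ≡ n
      n≡ = trans (sym (ℕₚ.+-suc m (2 ℕ.* d))) (ℕₚ.m∸n+n≡m (ℕₚ.≤-trans (ℕₚ.m≤n+m (suc (2 ℕ.* d)) (Y ℕ.+ M)) N₀≤n))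
      Y+M≤ : Y ℕ.+ M ℕ.≤ n ℕ.+ 2 ℕ.* d
      Y+M≤ = ℕₚ.≤-trans (ℕₚ.≤-trans (ℕₚ.m≤m+n (Y ℕ.+ M) (suc (2 ℕ.* d))) N₀≤n) (ℕₚ.m≤m+n n (2 ℕ.* d))
      Y≤y : Y ℕ.≤ y
      Y≤y = ℕₚ.m+n≤o⇒m≤o∸n Y Y+M≤
      y+M≡ : y ℕ.+ M ≡ suc m ℕ.+ 4 ℕ.* d
      y+M≡ = trans (ℕₚ.m∸n+n≡m (ℕₚ.≤-trans (ℕₚ.m≤n+m M Y) Y+M≤)) (trans (cong (ℕ._+ 2 ℕ.* d) (sym n≡))
        (trans (ℕₚ.+-assoc (suc m) (2 ℕ.* d) (2 ℕ.* d)) (cong (suc m ℕ.+_) (sym (ℕₚ.*-distribʳ-+ d 2 2)))))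

  -- Dimension zero and the two cases combined.

  vertexTuple₀ : (v : VertexTuple 0) → v ≡ [] ∷ []
  vertexTuple₀ ([] ∷ []) = refl

  singleton-enumerates : ∀ n (v : VertexTuple 0) → Enumerates n v (v ∷ [])
  singleton-enumerates n v = ([] ∷ []) , λ w → mk⇔ (λ { (here refl) → HorMin-refl n v (λ i ()) })
    (λ _ → here (trans (vertexTuple₀ w) (sym (vertexTuple₀ v))))

  -- All vertex tuples of dimension 0 coincide, so an enumeration is a one-element list, for which
  -- average and target compute to the same number.
  avgVol₀ : ∀ n (v : VertexTuple 0) L → Enumerates n v L → avgVol L ≡ muTarget v
  avgVol₀ n v []      (_ , h) = contradiction (Equivalence.from (h v) (HorMin-refl n v (λ i ()))) λ ()
  avgVol₀ n ([] ∷ []) (([] ∷ []) ∷ []) _ = refl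
  avgVol₀ n v (w ∷ u ∷ L) (((w≢u ∷ _) ∷ _) , _) = contradiction (trans (vertexTuple₀ w) (sym (vertexTuple₀ u))) w≢u

  enumeration : ∀ {d} (v : VertexTuple d) → LatticeSimplex v →
    ∀ n → 1 ℕ.≤ n → ∃ λ (L : List (VertexTuple d)) → Enumerates n v L
  enumeration {zero}   v _ n _ = v ∷ [] , singleton-enumerates n v
  enumeration {suc d′} v (V-int , det≢0) n 1≤n = minis n {{ℕ.>-nonZero 1≤n}} , minis-enumerates n {{ℕ.>-nonZero 1≤n}}
    where open Dimension≥1 v V-int (integralInverse (edgeMatrix v) (λ i j → int-sub (V-int (suc i) j) (V-int zero j)) det≢0)

  convergence : ∀ {d} (v : VertexTuple d) → LatticeSimplex v →
    ∀ ε → 0ℚ < ε → ∃ λ (N : ℕ) → ∀ n → N ℕ.≤ n → 1 ℕ.≤ n →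
    (L : List (VertexTuple d)) → Enumerates n v L → ∣ avgVol L - muTarget v ∣ < ε
  convergence {zero} v _ ε 0<ε = 0 , λ n _ _ L enum → subst (_< ε) (sym (trans
    (cong (λ z → ∣ z - muTarget v ∣) (avgVol₀ n v L enum)) (cong ∣_∣ (+-inverseʳ (muTarget v))))) 0<ε
  convergence {suc d′} v (V-int , det≢0) ε 0<ε =
      proj₁ Y ℕ.+ M ℕ.+ suc (2 ℕ.* suc d′)
    , λ n N≤n _ → converges ε (proj₁ Y) 0<ε (proj₂ Y) n N≤n
    where
    open Dimension≥1 v V-int (integralInverse (edgeMatrix v) (λ i j → int-sub (V-int (suc i) j) (V-int zero j)) det≢0)
    Y = archimedean (muTarget v * fromℕ M) ε 0<ε

open import Data.Nat using (ℕ; _≤_)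
open import Data.Vec using (Vec)
open import Data.List using (List)
open import Data.Rational using (ℚ; _<_; ∣_∣; 0ℚ; _-_)
open import Data.Product using (Σ; ∃; _×_; _,_)

-- The claim about all enumerations has content because the first component provides one for every n
-- ≥ 1.
theorem3 : ∀ (d : ℕ) (v : VertexTuple d) → LatticeSimplex v →
    ((n : ℕ) → 1 ≤ n → ∃ λ (L : List (VertexTuple d)) → Enumerates n v L)
    × ((ε : ℚ) → 0ℚ < ε → ∃ λ (N : ℕ) → (n : ℕ) → N ≤ n → 1 ≤ n →
        (L : List (VertexTuple d)) → Enumerates n v L →
        ∣ avgVol L - muTarget v ∣ < ε)
theorem3 d v simplex = Averages.enumeration v simplex , Averages.convergence v simplex
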